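{- Let $r\ge 1$ be an integer, let $\mathcal{M}_1,\ldots,\mathcal{M}_r$ be matroids on the same finite ground set $V$, and let $k$ be a real number. Let $d=r\lceil k\rceil-r+1$. Let $f_1,\ldots,f_d$ be non-negative real-valued functions on $V$ belonging to $\bigcap_{i\le r}P(\mathcal{M}_i)$ and satisfying $|f_j|\ge k$ for every $j\le d$. Let $F_j=\operatorname{supp}(f_j)$ for $j\le d$. Then there exists a function $f\in\bigcap_{i\le r}P(\mathcal{M}_i)$ such that $\operatorname{supp}(f)$ is a rainbow set of $(F_1,\ldots,F_d)$ and $|f|\ge k$.
   Context: For a function $f$ on $V$ and $A\subseteq V$, $f[A]=\sum_{a\in A}f(a)$, $|f|=f[V]$, and $\operatorname{supp}(f)=\{v\in V: f(v)\neq 0\}$. $\mathbb{R}_+$ denotes the non-negative reals. For a matroid $\mathcal{M}$ on $V$ with rank function $\operatorname{rk}_{\mathcal{M}}$, the matroid polytope is $$P(\mathcal{M})=\{f\in\mathbb{R}_+^V : f[A]\le \operatorname{rk}_{\mathcal{M}}(A)\ \text{for every } A\subseteq V\}.$$ For a family (multiset) of sets $(F_1,\ldots,F_m)$, a (partial) rainbow set is the image of a partial choice function, i.e. a set $R=\{x_{i_1},\ldots,x_{i_p}\}$ of distinct elements with $1\le i_1<i_2<\cdots<i_p\le m$ and $x_{i_j}\in F_{i_j}$ for every $j\le p$ (the empty set is allowed). If $d\le 0$, the family of functions is empty. -}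

module Defs where

open import Algebra.Bundles using (CommutativeRing)
import Algebra.Definitions.RawMonoid as RawMonoidDefs
import Algebra.Properties.Ring as RingProperties
open import Data.Bool.Base using (if_then_else_; true; false)
open import Data.Fin.Base using (Fin)
open import Data.Fin.Subset
  using (Subset; _∈_; _∉_; _⊆_; _∪_; ⁅_⁆; ∣_∣; ⊤; ⊥)
open import Data.Fin.Subset.Properties using (_⊆?_)
open import Data.Integer.Base as ℤ using (ℤ; +_; -[1+_])
import Data.Integer.Properties as ℤₚ
open import Data.List.Base as List using (List; []; _∷_; _++_)
open import Data.List.Extrema.Nat using (max)
open import Data.Maybe.Base using (Maybe; just)
open import Data.Nat.Base as ℕ using (ℕ; zero; suc; z≤n; s≤s)
import Data.Nat.Properties as ℕₚ
open import Data.Product.Base using (_×_; _,_; proj₁; proj₂; ∃; ∃-syntax)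
open import Data.Sum.Base using (inj₁; inj₂)
open import Data.Vec.Base as Vec using (Vec)
open import Data.Vec.Functional using (Vector)
open import Function.Bundles using (_⇔_)
open import Level using (0ℓ)
import Relation.Binary.Construct.NonStrictToStrict as NonStrictToStrict
open import Relation.Binary.PropositionalEquality.Core as ≡ using (_≡_)
open import Relation.Binary.Structures using (IsDecTotalOrder)
open import Relation.Nullary.Decidable using (Dec; yes; no; does; ¬?; _×-dec_)
open import Relation.Nullary.Negation using (¬_; contradiction)
open import Relation.Unary using (Decidable)

-- The library has no type of real numbers.  ℝ is axiomatised as a complete
-- ordered field, which determines it up to isomorphism.  These are the
-- classical reals, hence the decidable total order.  In `supremum` the usual
-- clause "every upper bound is ≥ s" is replaced by the approximation form
-- "everything below s is exceeded by a member of S", which is the same thing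
-- classically and implies the usual clause constructively.
record CompleteOrderedField : Set₁ where
  infix 4 _≤_
  field
    commutativeRing : CommutativeRing 0ℓ 0ℓ

  open CommutativeRing commutativeRing public

  field
    _≤_             : Carrier → Carrier → Set
    isDecTotalOrder : IsDecTotalOrder _≈_ _≤_

  open NonStrictToStrict _≈_ _≤_ public using (_<_)

  field
    1≉0       : ¬ (1# ≈ 0#)
    inverse   : ∀ x → ¬ (x ≈ 0#) → ∃[ y ] x * y ≈ 1#
    +-monoʳ-≤ : ∀ x {y z} → y ≤ z → x + y ≤ x + z
    *-nonNeg  : ∀ {x y} → 0# ≤ x → 0# ≤ y → 0# ≤ x * y
    supremum  : (S : Carrier → Set) → ∃ S → (∃[ b ] ∀ x → S x → x ≤ b) →
                ∃[ s ] (∀ x → S x → x ≤ s) × (∀ t → t < s → ∃[ x ] S x × t < x)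

  module ≤ = IsDecTotalOrder isDecTotalOrder
  open ≤ public using (_≟_; _≤?_)

module Ceiling (ℝ : CompleteOrderedField) where
  open CompleteOrderedField ℝ
  open RawMonoidDefs +-rawMonoid using () renaming (_×_ to _·_)
  open RingProperties ring using (-‿distribˡ-*; -‿involutive; -0#≈0#; -‿+-comm)
  private
    module NS = NonStrictToStrict _≈_ _≤_

  fromℕ : ℕ → Carrier
  fromℕ n = n · 1#

  fromℤ : ℤ → Carrier
  fromℤ (+ n)    = fromℕ n
  fromℤ -[1+ n ] = - fromℕ (suc n)

  private
    ≤-resp : ∀ {x x′ y y′} → x ≈ x′ → y ≈ y′ → x ≤ y → x′ ≤ y′
    ≤-resp p q x≤y =
      ≤.trans (≤.reflexive (sym p)) (≤.trans x≤y (≤.reflexive q))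

    +-monoˡ-≤ : ∀ x {y z} → y ≤ z → y + x ≤ z + x
    +-monoˡ-≤ x y≤z = ≤-resp (+-comm x _) (+-comm x _) (+-monoʳ-≤ x y≤z)

    cancel : ∀ x y → - x + (x + y) ≈ y
    cancel x y = trans (sym (+-assoc (- x) x y))
      (trans (+-congʳ (-‿inverseˡ x)) (+-identityˡ y))

    +-cancelˡ-≤ : ∀ x {y z} → x + y ≤ x + z → y ≤ z
    +-cancelˡ-≤ x p = ≤-resp (cancel x _) (cancel x _) (+-monoʳ-≤ (- x) p)

    -‿anti-≤ : ∀ {x y} → x ≤ y → - y ≤ - x
    -‿anti-≤ {x} {y} x≤y = +-cancelˡ-≤ x (≤-resp refl (sym (-‿inverseʳ x))
      (≤-resp refl (-‿inverseʳ y) (+-monoˡ-≤ (- y) x≤y)))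

    ≰⇒≤ : ∀ {x y} → ¬ (x ≤ y) → y ≤ x
    ≰⇒≤ {x} {y} x≰y with ≤.total x y
    ... | inj₁ x≤y = contradiction x≤y x≰y
    ... | inj₂ y≤x = y≤x

    <⇒≱ : ∀ {x y} → x < y → ¬ (y ≤ x)
    <⇒≱ = NS.<⇒≱ ≤.antisym

    ≰⇒> : ∀ {x y} → ¬ (x ≤ y) → y < x
    ≰⇒> x≰y = ≰⇒≤ x≰y , λ y≈x → x≰y (≤.reflexive (sym y≈x))

    0≤1 : 0# ≤ 1#
    0≤1 with ≤.total 0# 1#
    ... | inj₁ p = p
    ... | inj₂ 1≤0 = ≤-resp refl eq (*-nonNeg 0≤-1 0≤-1)
      where
      0≤-1 : 0# ≤ - 1#
      0≤-1 = ≤-resp -0#≈0# refl (-‿anti-≤ 1≤0)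
      eq : - 1# * - 1# ≈ 1#
      eq = trans (sym (-‿distribˡ-* 1# (- 1#)))
        (trans (-‿cong (*-identityˡ (- 1#))) (-‿involutive 1#))

    suc≰ : ∀ x → ¬ (1# + x ≤ x)
    suc≰ x p = 1≉0 (≤.antisym 1≤0 0≤1)
      where
      1≤0 : 1# ≤ 0#
      1≤0 = +-cancelˡ-≤ x (≤-resp (+-comm 1# x) (sym (+-identityʳ x)) p)

    fromℕ-nonNeg : ∀ n → 0# ≤ fromℕ n
    fromℕ-nonNeg zero    = ≤.refl
    fromℕ-nonNeg (suc n) = ≤.trans (fromℕ-nonNeg n)
      (≤-resp (+-identityˡ _) refl (+-monoˡ-≤ (fromℕ n) 0≤1))

    fromℕ-mono : ∀ {m n} → m ℕ.≤ n → fromℕ m ≤ fromℕ n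
    fromℕ-mono {n = n} z≤n = fromℕ-nonNeg n
    fromℕ-mono (s≤s m≤n)   = +-monoʳ-≤ 1# (fromℕ-mono m≤n)

    fromℤ-mono : ∀ {i j} → i ℤ.≤ j → fromℤ i ≤ fromℤ j
    fromℤ-mono (ℤ.-≤- n≤m) = -‿anti-≤ (fromℕ-mono (s≤s n≤m))
    fromℤ-mono (ℤ.-≤+ {m} {n}) = ≤.trans
      (≤-resp refl -0#≈0# (-‿anti-≤ (fromℕ-nonNeg (suc m)))) (fromℕ-nonNeg n)
    fromℤ-mono (ℤ.+≤+ m≤n) = fromℕ-mono m≤n

  archimedean : ∀ x → ∃[ n ] x ≤ fromℕ n
  archimedean x with x ≤? 0#
  ... | yes x≤0 = 0 , x≤0
  ... | no  x≰0 = bound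
    where
    S : Carrier → Set
    S y = ∃[ n ] y ≈ fromℕ n × y ≤ x

    bound : ∃[ n ] x ≤ fromℕ n
    bound with supremum S (0# , 0 , refl , ≰⇒≤ x≰0) (x , λ _ → λ (_ , _ , p) → p)
    ... | s , upper , approx
      with approx (- 1# + s) (≰⇒> λ p →
             suc≰ s (≤-resp refl s≈ (+-monoʳ-≤ 1# p)))
      where
      s≈ : 1# + (- 1# + s) ≈ s
      s≈ = trans (sym (+-assoc 1# (- 1#) s))
             (trans (+-congʳ (-‿inverseʳ 1#)) (+-identityˡ s))
    ... | y , (n , y≈n , _) , s-1<y with x ≤? fromℕ (suc n)
    ... | yes p = suc n , p
    ... | no ¬p = contradiction
      (≤-resp (trans (cancel 1# (fromℕ n)) (sym y≈n)) refl
        (+-monoʳ-≤ (- 1#) (upper (fromℕ (suc n)) (suc n , refl , ≰⇒≤ ¬p))))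
      (<⇒≱ s-1<y)

  private
    IsCeiling : Carrier → ℤ → Set
    IsCeiling x c = x ≤ fromℤ c × (∀ z → x ≤ fromℤ z → c ℤ.≤ z)

    search : ∀ x lo → ¬ (x ≤ fromℤ lo) → ∀ fuel c → x ≤ fromℤ c →
             c ℤ.≤ + fuel ℤ.+ lo → ∃ (IsCeiling x)
    search x lo x≰lo zero c x≤c c≤ = contradiction
      (≤.trans x≤c (fromℤ-mono (≡.subst (c ℤ.≤_) (ℤₚ.+-identityˡ lo) c≤))) x≰lo
    search x lo x≰lo (suc fuel) c x≤c c≤ with x ≤? fromℤ (ℤ.pred c)
    ... | yes p = search x lo x≰lo fuel (ℤ.pred c) p
      (≡.subst (ℤ.pred c ℤ.≤_)
        (≡.trans (≡.cong ℤ.pred (ℤₚ.suc-+ fuel lo))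
                 (ℤₚ.pred-suc (+ fuel ℤ.+ lo)))
        (ℤₚ.pred-mono c≤))
    ... | no ¬p = c , x≤c , least
      where
      least : ∀ z → x ≤ fromℤ z → c ℤ.≤ z
      least z x≤z with c ℤₚ.≤? z
      ... | yes c≤z = c≤z
      ... | no  c≰z = contradiction
        (≤.trans x≤z (fromℤ-mono (ℤₚ.i<j⇒i≤pred[j] (ℤₚ.≰⇒> c≰z)))) ¬p

  ceiling : ∀ x → ∃[ c ] x ≤ fromℤ c × (∀ z → x ≤ fromℤ z → c ℤ.≤ z)
  ceiling x with archimedean x | archimedean (- x)
  ... | n , x≤n | m , -x≤m =
    search x -[1+ m ] x≰lo (n ℕ.+ suc m) (+ n) x≤n
      (ℤₚ.≤-reflexive (≡.sym eq))
    where
    x≰lo : ¬ (x ≤ fromℤ -[1+ m ])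
    x≰lo p = suc≰ (fromℕ m) (≤.trans
      (≤-resp (-‿involutive _) refl (-‿anti-≤ p)) -x≤m)

    eq : + (n ℕ.+ suc m) ℤ.+ -[1+ m ] ≡ + n
    eq = ≡.trans (≡.cong (ℤ._+ -[1+ m ]) (ℤₚ.pos-+ n (suc m)))
      (≡.trans (ℤₚ.+-assoc (+ n) (+ suc m) -[1+ m ])
      (≡.trans (≡.cong (ℤ._+_ (+ n)) (ℤₚ.+-inverseʳ (+ suc m)))
               (ℤₚ.+-identityʳ (+ n))))

  ⌈_⌉ : Carrier → ℤ
  ⌈ x ⌉ = proj₁ (ceiling x)

record Matroid (n : ℕ) : Set₁ where
  field
    Independent  : Subset n → Set
    independent? : Decidable Independent
    ⊥-indep      : Independent ⊥
    hereditary   : ∀ {I J} → I ⊆ J → Independent J → Independent I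
    augmentation : ∀ {I J} → Independent I → Independent J → ∣ I ∣ ℕ.< ∣ J ∣ →
                   ∃[ x ] x ∈ J × x ∉ I × Independent (I ∪ ⁅ x ⁆)

allSubsets : ∀ n → List (Subset n)
allSubsets zero    = Vec.[] ∷ []
allSubsets (suc n) = List.map (false Vec.∷_) (allSubsets n)
                  ++ List.map (true  Vec.∷_) (allSubsets n)

rank : ∀ {n} → Matroid n → Subset n → ℕ
rank {n} M A = max 0 (List.map ∣_∣ (List.filter
  (λ I → independent? I ×-dec I ⊆? A) (allSubsets n)))
  where open Matroid M

module Functions (ℝ : CompleteOrderedField) where
  open CompleteOrderedField ℝ
  open Ceiling ℝ using (fromℕ)
  open RawMonoidDefs +-rawMonoid using (sum)

  infix 8 _[_]
  infix 4 _∈P_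

  _[_] : ∀ {n} → Vector Carrier n → Subset n → Carrier
  f [ A ] = sum λ v → if Vec.lookup A v then f v else 0#

  ∥_∥ : ∀ {n} → Vector Carrier n → Carrier
  ∥ f ∥ = f [ ⊤ ]

  supp : ∀ {n} → Vector Carrier n → Subset n
  supp f = Vec.tabulate λ v → does (¬? (f v ≟ 0#))

  _∈P_ : ∀ {n} → Vector Carrier n → Matroid n → Set
  f ∈P M = (∀ v → 0# ≤ f v) × (∀ A → f [ A ] ≤ fromℕ (rank M A))

-- The partial choice function is c, with c i ≡ nothing when no element is
-- chosen from F i; the third clause says the chosen elements are distinct.
IsRainbow : ∀ {m n} → (Fin m → Subset n) → Subset n → Set
IsRainbow {m} {n} F R = ∃ λ (c : Fin m → Maybe (Fin n)) →
    (∀ i x → c i ≡ just x → x ∈ F i)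
  × (∀ x → x ∈ R ⇔ (∃[ i ] c i ≡ just x))
  × (∀ i j x → c i ≡ just x → c j ≡ just x → i ≡ j)

-- A family indexed by j = 1, …, d is indexed by Fin (size d), empty if d ≤ 0.
size : ℤ → ℕ
size (+ n)    = n
size -[1+ _ ] = 0

{-# OPTIONS --safe #-}
-- A simplex argument with rainbow supports.  Perturb the bound
-- f[A] ≤ rk A by an infinitesimal of its own for every set A, a larger set having
-- a dominating one, so that vertices are nondegenerate and the bounds are strictly
-- submodular.  Then the tight sets of one matroid have distinct ranks, hence a
-- vertex f with |f| < k has at most r(⌈k⌉ - 1) < d tight sets and equally many
-- support elements.  If its support is rainbow, some colour j is unused.  Since
-- |f j| ≥ k > |f|, the vector f j - f is a combination of the edges at f in which
-- one that increases |f| must occur; it drops a tight set or brings in an element of F j,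
-- so following it keeps the support rainbow.  As |f| strictly increases, the climb ends
-- at |f| ≥ k, and forgetting the infinitesimals gives the required function.
module Submission where

open import Defs
open import Algebra.Bundles using (CommutativeRing)
import Algebra.Properties.Ring as RingProperties
import Algebra.Properties.Semiring.Mult as SemiringMult
import Algebra.Properties.Semiring.Sum as SemiringSum
import Algebra.Solver.Ring as RingSolver
open import Algebra.Solver.Ring.AlmostCommutativeRing
  using (fromCommutativeRing; _-Raw-AlmostCommutative⟶_; Induced-equivalence)
open import Data.Bool.Base using (Bool; true; false; if_then_else_; _∨_; _∧_)
import Data.Bool.Properties as Boolₚ
open import Data.Empty using (⊥; ⊥-elim)
open import Data.Fin.Base as Fin
  using (Fin; zero; suc; combine; splitAt; _↑ˡ_; _↑ʳ_; toℕ; inject₁; inject≤; fromℕ<)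
import Data.Fin.Properties as Finₚ
open import Data.Fin.Subset as Subset using (Subset; _∈_; _∉_; _⊆_; ∣_∣; _∪_; _∩_; ⁅_⁆)
open import Data.Fin.Subset.Properties
  using (_∈?_; _⊆?_; ∈⊤; ∉⊥; ∣⊥∣≡0; ∣p∣≤n; drop-there; drop-∷-⊆; ⊆-trans; ⊆-antisym;
         p⊆q⇒∣p∣≤∣q∣; p⊂q⇒∣p∣<∣q∣; p⊆p∪q; q⊆p∪q; p∩q⊆p; p∩q⊆q;
         x∈p∪q⁺; x∈p∪q⁻; x∈p∩q⁺; x∈p∩q⁻; x∈⁅x⁆; x∈⁅y⁆⇒x≡y)
open import Data.Integer.Base using (ℤ; +_) renaming (_+_ to _+ℤ_; _-_ to _-ℤ_; _*_ to _*ℤ_)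
open import Data.Integer.Base as ℤ using (-[1+_])
import Data.Integer.Properties as ℤₚ
open import Data.List.Base as List using (List; []; _∷_; length; filter)
open import Data.List.Extrema.Nat using (xs≤max; argmax-sel)
open import Data.List.Membership.Propositional using () renaming (_∈_ to _∈ₗ_)
open import Data.List.Membership.Propositional.Properties
  using (∈-filter⁺; ∈-filter⁻; ∈-++⁺ˡ; ∈-++⁺ʳ; ∈-map⁺; ∈-map⁻)
open import Data.List.Properties using (filter-notAll)
import Data.List.Relation.Unary.All as All
import Data.List.Relation.Unary.Any as Any
open import Data.Maybe.Base as Maybe using (Maybe; just; nothing)
import Data.Maybe.Properties as Maybeₚ
open import Data.Nat.Base using (ℕ) renaming (_≤_ to _≤ℕ_)
open import Data.Nat.Base as ℕ using (zero; suc)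
open import Data.Nat.Induction using (<-wellFounded)
import Data.Nat.Properties as ℕₚ
open import Data.Product.Base using (_×_; _,_; proj₁; proj₂; ∃; ∃-syntax)
open import Data.Sum.Base using (_⊎_; inj₁; inj₂)
open import Data.Unit.Base using (⊤; tt)
open import Data.Vec.Base as Vec using ([]; _∷_; here; there)
open import Data.Vec.Functional as Vector using (Vector)
import Data.Vec.Properties as Vecₚ
open import Function.Base using (_∘_; id)
open import Function.Bundles using (mk⇔)
open import Induction.WellFounded using (Acc; acc)
open import Level using (0ℓ)
open import Relation.Binary.PropositionalEquality.Core as ≡ using (_≡_; _≢_)
open import Relation.Binary.Definitions using (WeaklyDecidable)
import Relation.Binary.PropositionalEquality.Properties as ≡ using (module ≡-Reasoning)
import Relation.Binary.Reasoning.Setoid as SetoidReasoning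
open import Relation.Nullary.Decidable
  using (Dec; yes; no; does; ¬?; _×-dec_; dec-true; dec-false; dec⇒maybe)
open import Relation.Nullary.Negation using (¬_; contradiction)

-- Matroid rank and subsets

-- The count r(⌈k⌉ - 1) comes from real parts: a tight set A has f[A] = rk A up to infinitesimals,
-- so rk A is at most |f| < k, and it is at least 1; this leaves ⌈k⌉ - 1 possible ranks in each
-- matroid. Infinitesimals are coordinates of lexicographically ordered real vectors. The constraint
-- matrix stays real, so edges and directions are real, while right-hand sides, entries and step
-- lengths are vectors. Two obstacles shape the perturbation. Lowering a bound of rank 0 would make
-- the origin infeasible, so such a bound is raised to 1 first, and loops are kept out by the
-- colours instead, whose functions vanish on them. The nonnegativity bounds stay exact, because the
-- support has to be read off the tight rows. The f j may violate the perturbed bounds. They are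
-- compared with f in real parts only, which suffices because an original bound never exceeds the
-- real part of the perturbed one.

∈-allSubsets : ∀ {n} (S : Subset n) → S ∈ₗ allSubsets n
∈-allSubsets []          = Any.here ≡.refl
∈-allSubsets (false ∷ S) = ∈-++⁺ˡ (∈-map⁺ _ (∈-allSubsets S))
∈-allSubsets (true ∷ S)  = ∈-++⁺ʳ _ (∈-map⁺ _ (∈-allSubsets S))

∣p∪q∣+∣p∩q∣≡∣p∣+∣q∣ : ∀ {n} (p q : Subset n) → ∣ p ∪ q ∣ ℕ.+ ∣ p ∩ q ∣ ≡ ∣ p ∣ ℕ.+ ∣ q ∣
∣p∪q∣+∣p∩q∣≡∣p∣+∣q∣ []          []          = ≡.refl
∣p∪q∣+∣p∩q∣≡∣p∣+∣q∣ (true  ∷ p) (true  ∷ q) = ≡.cong suc (≡.trans (ℕₚ.+-suc _ _)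
  (≡.trans (≡.cong suc (∣p∪q∣+∣p∩q∣≡∣p∣+∣q∣ p q)) (≡.sym (ℕₚ.+-suc _ _))))
∣p∪q∣+∣p∩q∣≡∣p∣+∣q∣ (true  ∷ p) (false ∷ q) = ≡.cong suc (∣p∪q∣+∣p∩q∣≡∣p∣+∣q∣ p q)
∣p∪q∣+∣p∩q∣≡∣p∣+∣q∣ (false ∷ p) (true  ∷ q) =
  ≡.trans (≡.cong suc (∣p∪q∣+∣p∩q∣≡∣p∣+∣q∣ p q)) (≡.sym (ℕₚ.+-suc _ _))
∣p∪q∣+∣p∩q∣≡∣p∣+∣q∣ (false ∷ p) (false ∷ q) = ∣p∪q∣+∣p∩q∣≡∣p∣+∣q∣ p q

module Rank {n} (M : Matroid n) where
  open Matroid M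
  open import Data.Nat.Base using (_+_; _≤_)

  private
    _isIn?_ : ∀ I A → Dec (Independent I × I ⊆ A)
    I isIn? A = independent? I ×-dec I ⊆? A

    sizes : Subset n → List ℕ
    sizes A = List.map ∣_∣ (filter (_isIn? A) (allSubsets n))

  ∣independent∣≤rank : ∀ {I A} → Independent I → I ⊆ A → ∣ I ∣ ≤ rank M A
  ∣independent∣≤rank {I} {A} ind I⊆A = All.lookup (xs≤max 0 (sizes A))
    (∈-map⁺ ∣_∣ (∈-filter⁺ (_isIn? A) (∈-allSubsets I) (ind , I⊆A)))

  rank-attained : ∀ A → ∃[ I ] Independent I × I ⊆ A × ∣ I ∣ ≡ rank M A
  rank-attained A with argmax-sel id 0 (sizes A)
  -- The default `0` of `max` is attained by the empty set.
  ... | inj₁ rank≡0 = Subset.⊥ , ⊥-indep , (λ x∈⊥ → contradiction x∈⊥ ∉⊥) , ≡.trans (∣⊥∣≡0 n) (≡.sym rank≡0)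
  ... | inj₂ rank∈ with ∈-map⁻ ∣_∣ rank∈
  ...   | I , I∈ , rank≡∣I∣ with ∈-filter⁻ (_isIn? A) {xs = allSubsets n} I∈
  ...     | _ , ind , I⊆A = I , ind , I⊆A , ≡.sym rank≡∣I∣

  rank-mono : ∀ {A B} → A ⊆ B → rank M A ≤ rank M B
  rank-mono {A} A⊆B with rank-attained A
  ... | I , ind , I⊆A , ∣I∣≡ =
    ≡.subst (_≤ _) ∣I∣≡ (∣independent∣≤rank ind (⊆-trans I⊆A A⊆B))

  -- Augmenting from `K` never loses an element of the starting set and shrinks `n ∸ ∣ I ∣`, so it
  -- stops once `K` is matched in size.
  extend : ∀ {I K U} → Independent I → Independent K → I ⊆ U → K ⊆ U →
           ∃[ J ] Independent J × I ⊆ J × J ⊆ U × ∣ K ∣ ≤ ∣ J ∣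
  extend {I} {K} {U} indI indK I⊆U K⊆U = go indI I⊆U (<-wellFounded _)
    where
    go : ∀ {I} → Independent I → I ⊆ U → Acc ℕ._<_ (n ℕ.∸ ∣ I ∣) →
         ∃[ J ] Independent J × I ⊆ J × J ⊆ U × ∣ K ∣ ≤ ∣ J ∣
    go {I} indI I⊆U (acc rec) with ∣ K ∣ ℕₚ.≤? ∣ I ∣
    ... | yes K≤I = I , indI , id , I⊆U , K≤I
    ... | no  K≰I with augmentation indI indK (ℕₚ.≰⇒> K≰I)
    ...   | x , x∈K , x∉I , indIx with go indIx Ix⊆U (rec (ℕₚ.∸-monoʳ-< ∣I∣<∣Ix∣ (∣p∣≤n (I ∪ ⁅ x ⁆))))
      where
      Ix⊆U : I ∪ ⁅ x ⁆ ⊆ U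
      Ix⊆U y∈ with x∈p∪q⁻ I ⁅ x ⁆ y∈
      ... | inj₁ y∈I = I⊆U y∈I
      ... | inj₂ y∈x = ≡.subst (_∈ U) (≡.sym (x∈⁅y⁆⇒x≡y x y∈x)) (K⊆U x∈K)
      ∣I∣<∣Ix∣ : ∣ I ∣ ℕ.< ∣ I ∪ ⁅ x ⁆ ∣
      ∣I∣<∣Ix∣ = p⊂q⇒∣p∣<∣q∣ (p⊆p∪q ⁅ x ⁆ , x , q⊆p∪q I ⁅ x ⁆ (x∈⁅x⁆ x) , x∉I)
    ...     | J , indJ , Ix⊆J , J⊆U , K≤J = J , indJ , ⊆-trans (p⊆p∪q ⁅ x ⁆) Ix⊆J , J⊆U , K≤J

  -- Grow a maximum independent subset of `A ∩ B` to `J` inside `A ∪ B`. The traces of `J` on `A`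
  -- and `B` are independent, cover `J` and share the original set, so counting them compares all
  -- four ranks.
  rank-submodular : ∀ A B → rank M (A ∪ B) + rank M (A ∩ B) ≤ rank M A + rank M B
  rank-submodular A B with rank-attained (A ∩ B) | rank-attained (A ∪ B)
  ... | I , indI , I⊆A∩B , ∣I∣≡ | K , indK , K⊆A∪B , ∣K∣≡
    with extend indI indK (⊆-trans I⊆A∩B (⊆-trans (p∩q⊆p A B) (p⊆p∪q B))) K⊆A∪B
  ... | J , indJ , I⊆J , J⊆A∪B , ∣K∣≤∣J∣ = begin
    rank M (A ∪ B) + rank M (A ∩ B)                ≡⟨ ≡.cong₂ _+_ ∣K∣≡ ∣I∣≡ ⟨
    ∣ K ∣ + ∣ I ∣                                  ≤⟨ ℕₚ.+-mono-≤ (ℕₚ.≤-trans ∣K∣≤∣J∣ (p⊆q⇒∣p∣≤∣q∣ J⊆)) (p⊆q⇒∣p∣≤∣q∣ I⊆) ⟩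
    ∣ (J ∩ A) ∪ (J ∩ B) ∣ + ∣ (J ∩ A) ∩ (J ∩ B) ∣  ≡⟨ ∣p∪q∣+∣p∩q∣≡∣p∣+∣q∣ (J ∩ A) (J ∩ B) ⟩
    ∣ J ∩ A ∣ + ∣ J ∩ B ∣                          ≤⟨ ℕₚ.+-mono-≤ (trace A) (trace B) ⟩
    rank M A + rank M B                            ∎
    where
    open ℕₚ.≤-Reasoning
    trace : ∀ C → ∣ J ∩ C ∣ ≤ rank M C
    trace C = ∣independent∣≤rank (hereditary (p∩q⊆p J C) indJ) (p∩q⊆q J C)
    J⊆ : J ⊆ (J ∩ A) ∪ (J ∩ B)
    J⊆ x∈J with x∈p∪q⁻ A B (J⊆A∪B x∈J)
    ... | inj₁ x∈A = x∈p∪q⁺ (inj₁ (x∈p∩q⁺ (x∈J , x∈A)))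
    ... | inj₂ x∈B = x∈p∪q⁺ (inj₂ (x∈p∩q⁺ (x∈J , x∈B)))
    I⊆ : I ⊆ (J ∩ A) ∩ (J ∩ B)
    I⊆ x∈I = x∈p∩q⁺ (x∈p∩q⁺ (I⊆J x∈I , proj₁ (x∈p∩q⁻ A B (I⊆A∩B x∈I))) ,
                     x∈p∩q⁺ (I⊆J x∈I , proj₂ (x∈p∩q⁻ A B (I⊆A∩B x∈I))))

-- Codes of subsets

combine-monoʳ-< : ∀ {m n} (i : Fin m) {k l : Fin n} → k Fin.< l → combine i k Fin.< combine i l
combine-monoʳ-< {n = n} i {k} {l} k<l = ≡.subst₂ ℕ._<_
  (≡.sym (Finₚ.toℕ-combine i k)) (≡.sym (Finₚ.toℕ-combine i l)) (ℕₚ.+-monoʳ-< (n ℕ.* toℕ i) k<l)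

private
  flag : Bool → Fin 2
  flag true  = zero
  flag false = suc zero

  flag-surjective : ∀ i → ∃[ x ] flag x ≡ i
  flag-surjective zero       = true , ≡.refl
  flag-surjective (suc zero) = false , ≡.refl

-- Larger sets receive smaller codes.
encode : ∀ {n} → Subset n → Fin (2 ℕ.^ n)
encode []      = zero
encode (x ∷ A) = combine (flag x) (encode A)

encode-surjective : ∀ {n} (k : Fin (2 ℕ.^ n)) → ∃ λ (A : Subset n) → encode A ≡ k
encode-surjective {zero}  zero = [] , ≡.refl
encode-surjective {suc n} k with Finₚ.combine-surjective {2} {2 ℕ.^ n} k
... | i , l , ≡.refl with flag-surjective i | encode-surjective {n} l
...   | x , ≡.refl | A , ≡.refl = x ∷ A , ≡.refl

encode-injective : ∀ {n} {A B : Subset n} → encode A ≡ encode B → A ≡ B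
encode-injective {A = []}    {[]}    eq = ≡.refl
encode-injective {A = x ∷ A} {y ∷ B} eq with Finₚ.combine-injective (flag x) (encode A) (flag y) (encode B) eq
encode-injective {A = true ∷ A}  {true ∷ B}  eq | _ , eq′ = ≡.cong (true ∷_) (encode-injective eq′)
encode-injective {A = false ∷ A} {false ∷ B} eq | _ , eq′ = ≡.cong (false ∷_) (encode-injective eq′)

-- The head is the leading binary digit and membership is the digit 0, so at the first place where
-- nested sets differ the larger set has the smaller digit.
encode-anti : ∀ {n} {A B : Subset n} → A ⊆ B → A ≢ B → encode B Fin.< encode A
encode-anti {A = []}        {[]}        A⊆B A≢B = contradiction ≡.refl A≢B
encode-anti {suc n} {true ∷ A}  {true ∷ B}  A⊆B A≢B =
  combine-monoʳ-< {2} {2 ℕ.^ n} zero (encode-anti (drop-∷-⊆ A⊆B) (A≢B ∘ ≡.cong (true ∷_)))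
encode-anti {suc n} {true ∷ A}  {false ∷ B} A⊆B A≢B = contradiction (A⊆B here) λ ()
encode-anti {suc n} {false ∷ A} {true ∷ B}  A⊆B A≢B =
  Finₚ.combine-monoˡ-< {2} {2 ℕ.^ n} {zero} {suc zero} (encode B) (encode A) ℕ.z<s
encode-anti {suc n} {false ∷ A} {false ∷ B} A⊆B A≢B =
  combine-monoʳ-< {2} {2 ℕ.^ n} (suc zero) (encode-anti (drop-∷-⊆ A⊆B) (A≢B ∘ ≡.cong (false ∷_)))

-- Counting and choice functions

enumerate : ∀ {m} (S : Subset m) → ∃[ e ] (∀ x → e x ∈ S) × (∀ {x y : Fin ∣ S ∣} → e x ≡ e y → x ≡ y)
enumerate [] = (λ ()) , (λ ()) , λ {}
enumerate (true ∷ S) with enumerate S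
... | e , e∈ , e-inj = e⁺ , e⁺∈ , λ {x} {y} → e⁺-inj x y
  where
  e⁺ : Fin (suc ∣ S ∣) → Fin _
  e⁺ zero    = zero
  e⁺ (suc x) = suc (e x)
  e⁺∈ : ∀ x → e⁺ x ∈ true ∷ S
  e⁺∈ zero    = here
  e⁺∈ (suc x) = there (e∈ x)
  e⁺-inj : ∀ x y → e⁺ x ≡ e⁺ y → x ≡ y
  e⁺-inj zero    zero    eq = ≡.refl
  e⁺-inj (suc x) (suc y) eq = ≡.cong suc (e-inj (Finₚ.suc-injective eq))
enumerate (false ∷ S) with enumerate S
... | e , e∈ , e-inj = suc ∘ e , there ∘ e∈ , e-inj ∘ Finₚ.suc-injective

-- Sending one extra point to the missed `v` would inject `suc n` points into `n`. The map may
-- depend on the membership proof, as the index of a tight row does.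
injection-misses-none : ∀ {m n} (S : Subset m) → ∣ S ∣ ≡ n → (φ : ∀ {t} → t ∈ S → Fin n) →
  (∀ {s t} (p : s ∈ S) (q : t ∈ S) → φ p ≡ φ q → s ≡ t) → ∀ v → ¬ (∀ {t} (p : t ∈ S) → φ p ≢ v)
injection-misses-none S ≡.refl φ φ-inj v misses with enumerate S
... | e , e∈ , e-inj = ℕₚ.1+n≰n (Finₚ.injective⇒≤ {f = ψ} λ {x} {y} → ψ-inj x y)
  where
  ψ : Fin (suc ∣ S ∣) → Fin ∣ S ∣
  ψ zero    = v
  ψ (suc x) = φ (e∈ x)
  ψ-inj : ∀ x y → ψ x ≡ ψ y → x ≡ y
  ψ-inj zero    zero    eq = ≡.refl
  ψ-inj zero    (suc y) eq = contradiction (≡.sym eq) (misses (e∈ y))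
  ψ-inj (suc x) zero    eq = contradiction eq (misses (e∈ x))
  ψ-inj (suc x) (suc y) eq = ≡.cong suc (e-inj (φ-inj (e∈ x) (e∈ y) eq))

module _ {A : Set} {P : A → Set} (P? : ∀ x → Dec (P x)) where

  -- Applied to every colour, this cuts a choice function that covers a support down to one whose
  -- image is that support.
  keep : Maybe A → Maybe A
  keep nothing  = nothing
  keep (just x) with P? x
  ... | yes _ = just x
  ... | no  _ = nothing

  keep⁻ : ∀ x {y} → keep x ≡ just y → x ≡ just y × P y
  keep⁻ (just x) eq with P? x
  keep⁻ (just x) ≡.refl | yes px = ≡.refl , px

  keep⁺ : ∀ {x y} → x ≡ just y → P y → keep x ≡ just y
  keep⁺ {y = y} ≡.refl py with P? y
  ... | yes _  = ≡.refl
  ... | no ¬py = contradiction py ¬py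

-- Ordered fields and lexicographic vectors

-- The solver needs coefficients that compute: integers do, the elements of an abstract ring do not.
module IntegerSolver (R : CommutativeRing 0ℓ 0ℓ) where
  open CommutativeRing R hiding (zero)
  open RingProperties ring
  open SemiringMult semiring using (×-homo-+; ×1-homo-*) renaming (_×_ to _·_)
  open SetoidReasoning setoid

  private
    ι : ℤ → Carrier
    ι (+ n)    = n · 1#
    ι -[1+ n ] = - (suc n · 1#)

    ι-neg : ∀ i → ι (ℤ.- i) ≈ - ι i
    ι-neg (+ zero)  = sym -0#≈0#
    ι-neg (+ suc n) = refl
    ι-neg -[1+ n ]  = sym (-‿involutive _)

    -‿cancel : ∀ x y z → (x + y) - (x + z) ≈ y - z
    -‿cancel x y z = begin
      (x + y) - (x + z)       ≈⟨ +-cong (+-comm x y) (sym (-‿+-comm x z)) ⟩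
      (y + x) + (- x + - z)   ≈⟨ +-assoc y x _ ⟩
      y + (x + (- x + - z))   ≈⟨ +-congˡ (sym (+-assoc x (- x) (- z))) ⟩
      y + ((x + - x) + - z)   ≈⟨ +-congˡ (+-congʳ (-‿inverseʳ x)) ⟩
      y + (0# + - z)          ≈⟨ +-congˡ (+-identityˡ (- z)) ⟩
      y - z                   ∎

    ι-⊖ : ∀ m n → ι (m ℤ.⊖ n) ≈ m · 1# - n · 1#
    ι-⊖ zero    zero    = sym (-‿inverseʳ 0#)
    ι-⊖ zero    (suc n) = sym (+-identityˡ _)
    ι-⊖ (suc m) zero    = sym (trans (+-congˡ -0#≈0#) (+-identityʳ _))
    ι-⊖ (suc m) (suc n) = begin
      ι (suc m ℤ.⊖ suc n)               ≡⟨ ≡.cong ι (ℤₚ.[1+m]⊖[1+n]≡m⊖n m n) ⟩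
      ι (m ℤ.⊖ n)                       ≈⟨ ι-⊖ m n ⟩
      m · 1# - n · 1#                   ≈⟨ sym (-‿cancel 1# _ _) ⟩
      suc m · 1# - suc n · 1#           ∎

    ι-+ : ∀ i j → ι (i ℤ.+ j) ≈ ι i + ι j
    ι-+ (+ m)    (+ n)    = ×-homo-+ 1# m n
    ι-+ (+ m)    -[1+ n ] = ι-⊖ m (suc n)
    ι-+ -[1+ m ] (+ n)    = trans (ι-⊖ n (suc m)) (+-comm _ _)
    ι-+ -[1+ m ] -[1+ n ] = begin
      - (suc (suc (m ℕ.+ n)) · 1#)      ≡⟨ ≡.cong (λ k → - (suc k · 1#)) (ℕₚ.+-suc m n) ⟨
      - ((suc m ℕ.+ suc n) · 1#)        ≈⟨ -‿cong (×-homo-+ 1# (suc m) (suc n)) ⟩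
      - (suc m · 1# + suc n · 1#)       ≈⟨ sym (-‿+-comm _ _) ⟩
      - (suc m · 1#) - suc n · 1#       ∎

    ι-*⁺ : ∀ i n → ι (i ℤ.* + n) ≈ ι i * ι (+ n)
    ι-*⁺ (+ m) n = begin
      ι (+ m ℤ.* + n)          ≡⟨ ≡.cong ι (ℤₚ.pos-* m n) ⟨
      (m ℕ.* n) · 1#           ≈⟨ ×1-homo-* m n ⟩
      (m · 1#) * (n · 1#)      ∎
    ι-*⁺ -[1+ m ] n = begin
      ι (-[1+ m ] ℤ.* + n)       ≡⟨ ≡.cong ι (ℤₚ.neg-distribˡ-* (+ suc m) (+ n)) ⟨
      ι (ℤ.- (+ suc m ℤ.* + n))  ≈⟨ ι-neg (+ suc m ℤ.* + n) ⟩
      - ι (+ suc m ℤ.* + n)      ≈⟨ -‿cong (ι-*⁺ (+ suc m) n) ⟩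
      - (suc m · 1# * (n · 1#))  ≈⟨ -‿distribˡ-* _ _ ⟩
      - (suc m · 1#) * (n · 1#)  ∎

    ι-* : ∀ i j → ι (i ℤ.* j) ≈ ι i * ι j
    ι-* i (+ n)    = ι-*⁺ i n
    ι-* i -[1+ n ] = begin
      ι (i ℤ.* -[1+ n ])         ≡⟨ ≡.cong ι (ℤₚ.neg-distribʳ-* i (+ suc n)) ⟨
      ι (ℤ.- (i ℤ.* + suc n))    ≈⟨ ι-neg (i ℤ.* + suc n) ⟩
      - ι (i ℤ.* + suc n)        ≈⟨ -‿cong (ι-*⁺ i (suc n)) ⟩
      - (ι i * (suc n · 1#))     ≈⟨ -‿distribʳ-* _ _ ⟩
      ι i * - (suc n · 1#)       ∎

    morphism : ℤ.+-*-rawRing -Raw-AlmostCommutative⟶ fromCommutativeRing R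
    morphism = record
      { ⟦_⟧ = ι ; +-homo = ι-+ ; *-homo = ι-* ; -‿homo = ι-neg
      ; 0-homo = refl ; 1-homo = +-identityʳ 1# }

    equal-coefficients : WeaklyDecidable (Induced-equivalence morphism)
    equal-coefficients i j = Maybe.map (λ { ≡.refl → refl }) (dec⇒maybe (i ℤₚ.≟ j))

  open RingSolver ℤ.+-*-rawRing (fromCommutativeRing R) morphism equal-coefficients public

module OrderedField (ℝ : CompleteOrderedField) where
  open CompleteOrderedField ℝ hiding (zero)
  open Ceiling ℝ using (fromℕ)
  open IntegerSolver commutativeRing using (solve; _:+_; _:*_; :-_; _:-_; _:=_)
  open RingProperties ring using (-0#≈0#; -‿involutive)
  open SemiringMult semiring using (×-homo-+)

  Pos : Carrier → Set
  Pos x = 0# < x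

  ≤-resp : ∀ {x x′ y y′} → x ≈ x′ → y ≈ y′ → x ≤ y → x′ ≤ y′
  ≤-resp p q x≤y =
    ≤.trans (≤.reflexive (sym p)) (≤.trans x≤y (≤.reflexive q))

  pos-resp : ∀ {x y} → x ≈ y → Pos x → Pos y
  pos-resp x≈y (0≤x , 0≉x) = ≤-resp refl x≈y 0≤x , λ 0≈y → 0≉x (trans 0≈y (sym x≈y))

  nonneg-+ : ∀ {x y} → 0# ≤ x → 0# ≤ y → 0# ≤ x + y
  nonneg-+ {x} p q = ≤.trans p (≤-resp (+-identityʳ x) refl (+-monoʳ-≤ x q))

  +-mono-≤ : ∀ {x y u v} → x ≤ y → u ≤ v → x + u ≤ y + v
  +-mono-≤ {x} {y} {u} {v} p q =
    ≤.trans (+-monoʳ-≤ x q) (≤-resp (+-comm v x) (+-comm v y) (+-monoʳ-≤ v p))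

  nonneg⇒≤ : ∀ {x y} → 0# ≤ y - x → x ≤ y
  nonneg⇒≤ {x} {y} p = ≤-resp (+-identityʳ x)
    (solve 2 (λ x y → x :+ (y :- x) := y) refl x y) (+-monoʳ-≤ x p)

  ≤⇒nonneg : ∀ {x y} → x ≤ y → 0# ≤ y - x
  ≤⇒nonneg {x} {y} p = ≤-resp (-‿inverseˡ x) (+-comm (- x) y) (+-monoʳ-≤ (- x) p)

  neg-nonneg⇒nonpos : ∀ {x} → 0# ≤ - x → x ≤ 0#
  neg-nonneg⇒nonpos {x} p = nonneg⇒≤ (≤-resp refl (sym (+-identityˡ (- x))) p)

  nonpos⇒neg-nonneg : ∀ {x} → x ≤ 0# → 0# ≤ - x
  nonpos⇒neg-nonneg {x} p = ≤-resp refl (+-identityˡ (- x)) (≤⇒nonneg p)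

  pos-+ : ∀ {x y} → Pos x → 0# ≤ y → Pos (x + y)
  pos-+ {x} {y} (p , 0≉x) q = nonneg-+ p q , λ 0≈x+y →
    0≉x (≤.antisym p (≤-resp (+-identityʳ x) (sym 0≈x+y) (+-monoʳ-≤ x q)))

  ≉0-cancel : ∀ {x y} → ¬ (x ≈ 0#) → x * y ≈ 0# → y ≈ 0#
  ≉0-cancel {x} {y} x≉0 xy≈0 with inverse x x≉0
  ... | z , xz≈1 = trans (sym (*-identityˡ y)) (trans (*-congʳ (sym xz≈1))
    (trans (solve 3 (λ x y z → (x :* z) :* y := z :* (x :* y)) refl x y z)
      (trans (*-congˡ xy≈0) (zeroʳ z))))

  pos⇒≉0 : ∀ {x} → Pos x → ¬ (x ≈ 0#)
  pos⇒≉0 (_ , 0≉x) x≈0 = 0≉x (sym x≈0)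

  pos-* : ∀ {x y} → Pos x → Pos y → Pos (x * y)
  pos-* px py = *-nonNeg (proj₁ px) (proj₁ py) , λ 0≈xy →
    pos⇒≉0 py (≉0-cancel (pos⇒≉0 px) (sym 0≈xy))

  pos-asym : ∀ {x} → Pos x → ¬ Pos (- x)
  pos-asym {x} p q = proj₂ (pos-+ p (proj₁ q)) (sym (-‿inverseʳ x))

  data Sign (x : Carrier) : Set where
    pos  : Pos x → Sign x
    nil  : x ≈ 0# → Sign x
    neg  : Pos (- x) → Sign x

  sign : ∀ x → Sign x
  sign x with x ≟ 0#
  ... | yes x≈0 = nil x≈0
  ... | no  x≉0 with ≤.total 0# x
  ...   | inj₁ 0≤x = pos (0≤x , λ 0≈x → x≉0 (sym 0≈x))
  ...   | inj₂ x≤0 = neg (nonpos⇒neg-nonneg x≤0 , λ 0≈-x →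
          x≉0 (trans (sym (-‿involutive x)) (trans (-‿cong (sym 0≈-x)) -0#≈0#)))

  ¬pos⇒≤0 : ∀ {x} → ¬ Pos x → x ≤ 0#
  ¬pos⇒≤0 {x} ¬p with sign x
  ... | pos p   = contradiction p ¬p
  ... | nil x≈0 = ≤.reflexive x≈0
  ... | neg p   = neg-nonneg⇒nonpos (proj₁ p)

  pos? : ∀ x → Dec (Pos x)
  pos? x with sign x
  ... | pos p   = yes p
  ... | nil x≈0 = no λ p → pos⇒≉0 p x≈0
  ... | neg p   = no λ q → pos-asym q p

  pos-1 : Pos 1#
  pos-1 with sign 1#
  ... | pos p   = p
  ... | nil 1≈0 = contradiction 1≈0 1≉0
  ... | neg p   = pos-resp (trans (solve 1 (λ x → :- x :* :- x := x :* x) refl 1#) (*-identityˡ 1#)) (pos-* p p)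

  pos-inverse : ∀ {x} → Pos x → ∃[ y ] Pos y × x * y ≈ 1#
  pos-inverse {x} p with inverse x (pos⇒≉0 p)
  ... | y , xy≈1 with sign y
  ...   | pos q   = y , q , xy≈1
  ...   | nil y≈0 = contradiction (trans (sym xy≈1) (trans (*-congˡ y≈0) (zeroʳ x))) 1≉0
  ...   | neg q   = ⊥-elim (pos-asym pos-1 (pos-resp
          (trans (solve 2 (λ x y → x :* :- y := :- (x :* y)) refl x y) (-‿cong xy≈1)) (pos-* p q)))

  fromℕ-nonneg : ∀ n → 0# ≤ fromℕ n
  fromℕ-nonneg zero    = ≤.refl
  fromℕ-nonneg (suc n) = nonneg-+ (proj₁ pos-1) (fromℕ-nonneg n)

  fromℕ-+ : ∀ m n → fromℕ (m ℕ.+ n) ≈ fromℕ m + fromℕ n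
  fromℕ-+ = ×-homo-+ 1#

  pos-fromℕ : ∀ {n} → 1 ℕ.≤ n → Pos (fromℕ n)
  pos-fromℕ {suc n} _ = pos-+ pos-1 (fromℕ-nonneg n)

  fromℕ-mono : ∀ {m n} → m ℕ.≤ n → fromℕ m ≤ fromℕ n
  fromℕ-mono {n = n} ℕ.z≤n = fromℕ-nonneg n
  fromℕ-mono (ℕ.s≤s m≤n)   = +-monoʳ-≤ 1# (fromℕ-mono m≤n)

  fromℕ-cancel-≤ : ∀ {m n} → fromℕ m ≤ fromℕ n → m ℕ.≤ n
  fromℕ-cancel-≤ {zero}          p = ℕ.z≤n
  fromℕ-cancel-≤ {suc m} {zero}  p =
    ⊥-elim (proj₂ (pos-+ pos-1 (fromℕ-nonneg m)) (≤.antisym (proj₁ (pos-+ pos-1 (fromℕ-nonneg m))) p))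
  fromℕ-cancel-≤ {suc m} {suc n} p = ℕ.s≤s (fromℕ-cancel-≤
    (≤-resp (cancel _) (cancel _) (+-monoʳ-≤ (- 1#) p)))
    where
    cancel : ∀ y → - 1# + (1# + y) ≈ y
    cancel = solve 2 (λ x y → :- x :+ (x :+ y) := y) refl 1#

  fromℕ-injective : ∀ {m n} → fromℕ m ≈ fromℕ n → m ≡ n
  fromℕ-injective p = ℕₚ.≤-antisym
    (fromℕ-cancel-≤ (≤.reflexive p)) (fromℕ-cancel-≤ (≤.reflexive (sym p)))

module Lexicographic (ℝ : CompleteOrderedField) where
  open CompleteOrderedField ℝ hiding (zero)
  open OrderedField ℝ
  open RingProperties ring using (-0#≈0#)

  -- Coordinate `zero` is the real part; each later one is the coefficient of an infinitesimal
  -- dominated by all earlier ones.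
  LexPos : ∀ {N} → Vector Carrier N → Set
  LexPos {zero}  x = ⊥
  LexPos {suc N} x = Pos (x zero) ⊎ (x zero ≈ 0# × LexPos λ c → x (suc c))

  Zero : ∀ {N} → Vector Carrier N → Set
  Zero x = ∀ c → x c ≈ 0#

  LexNonNeg : ∀ {N} → Vector Carrier N → Set
  LexNonNeg x = LexPos x ⊎ Zero x

  lexPos-resp : ∀ {N} {x y : Vector Carrier N} → (∀ c → x c ≈ y c) → LexPos x → LexPos y
  lexPos-resp {suc N} e (inj₁ p)       = inj₁ (pos-resp (e zero) p)
  lexPos-resp {suc N} e (inj₂ (z , p)) =
    inj₂ (trans (sym (e zero)) z , lexPos-resp (λ c → e (suc c)) p)

  lexNonNeg-resp : ∀ {N} {x y : Vector Carrier N} → (∀ c → x c ≈ y c) → LexNonNeg x → LexNonNeg y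
  lexNonNeg-resp e (inj₁ p) = inj₁ (lexPos-resp e p)
  lexNonNeg-resp e (inj₂ z) = inj₂ λ c → trans (sym (e c)) (z c)

  lexPos-+ : ∀ {N} {x y : Vector Carrier N} → LexPos x → LexPos y → LexPos (λ c → x c + y c)
  lexPos-+ {suc N} (inj₁ p)       (inj₁ q)       = inj₁ (pos-+ p (proj₁ q))
  lexPos-+ {suc N} (inj₁ p)       (inj₂ (w , q)) = inj₁ (pos-+ p (≤.reflexive (sym w)))
  lexPos-+ {suc N} (inj₂ (z , p)) (inj₁ q)       =
    inj₁ (pos-resp (+-comm _ _) (pos-+ q (≤.reflexive (sym z))))
  lexPos-+ {suc N} (inj₂ (z , p)) (inj₂ (w , q)) =
    inj₂ (trans (+-cong z w) (+-identityˡ 0#) , lexPos-+ p q)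

  lexPos-+-nonNeg : ∀ {N} {x y : Vector Carrier N} → LexPos x → LexNonNeg y →
                    LexPos (λ c → x c + y c)
  lexPos-+-nonNeg p (inj₁ q) = lexPos-+ p q
  lexPos-+-nonNeg p (inj₂ w) =
    lexPos-resp (λ c → sym (trans (+-congˡ (w c)) (+-identityʳ _))) p

  lexNonNeg-+ : ∀ {N} {x y : Vector Carrier N} → LexNonNeg x → LexNonNeg y →
                LexNonNeg (λ c → x c + y c)
  lexNonNeg-+ (inj₁ p) q = inj₁ (lexPos-+-nonNeg p q)
  lexNonNeg-+ (inj₂ z) q =
    lexNonNeg-resp (λ c → sym (trans (+-congʳ (z c)) (+-identityˡ _))) q

  lexPos-* : ∀ {N} {a} {x : Vector Carrier N} → Pos a → LexPos x → LexPos (λ c → x c * a)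
  lexPos-* {suc N} p (inj₁ q)       = inj₁ (pos-* q p)
  lexPos-* {suc N} p (inj₂ (z , q)) =
    inj₂ (trans (*-congʳ z) (zeroˡ _) , lexPos-* p q)

  lexNonNeg-* : ∀ {N} {a} {x : Vector Carrier N} → 0# ≤ a → LexPos x → LexNonNeg (λ c → x c * a)
  lexNonNeg-* {a = a} 0≤a p with 0# ≟ a
  ... | yes 0≈a = inj₂ λ c → trans (*-congˡ (sym 0≈a)) (zeroʳ _)
  ... | no  0≉a = inj₁ (lexPos-* (0≤a , 0≉a) p)

  lexPos⇒¬zero : ∀ {N} {x : Vector Carrier N} → LexPos x → ¬ Zero x
  lexPos⇒¬zero {suc N} (inj₁ p)       z = pos⇒≉0 p (z zero)
  lexPos⇒¬zero {suc N} (inj₂ (_ , p)) z = lexPos⇒¬zero p (λ c → z (suc c))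

  lexPos-nonNeg-asym : ∀ {N} {x : Vector Carrier N} → LexPos x → ¬ LexNonNeg (λ c → - x c)
  lexPos-nonNeg-asym p q = lexPos⇒¬zero (lexPos-+-nonNeg p q) λ c → -‿inverseʳ _

  data LexSign {N} (x : Vector Carrier N) : Set where
    pos  : LexPos x → LexSign x
    nil  : Zero x → LexSign x
    neg  : LexPos (λ c → - x c) → LexSign x

  lexSign : ∀ {N} (x : Vector Carrier N) → LexSign x
  lexSign {zero}  x = nil λ ()
  lexSign {suc N} x with sign (x zero)
  ... | pos p = pos (inj₁ p)
  ... | neg p = neg (inj₁ p)
  ... | nil z with lexSign (λ c → x (suc c))
  ...   | pos p = pos (inj₂ (z , p))
  ...   | neg p = neg (inj₂ (trans (-‿cong z) -0#≈0# , p))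
  ...   | nil w = nil λ { zero → z ; (suc c) → w c }

  lexNonNeg-head : ∀ {N} {x : Vector Carrier (suc N)} → LexNonNeg x → 0# ≤ x zero
  lexNonNeg-head (inj₁ (inj₁ p))       = proj₁ p
  lexNonNeg-head (inj₁ (inj₂ (z , _))) = ≤.reflexive (sym z)
  lexNonNeg-head (inj₂ z)              = ≤.reflexive (sym (z zero))

-- Linear algebra

module LinearAlgebra (ℝ : CompleteOrderedField) where
  open CompleteOrderedField ℝ hiding (zero)
  open Ceiling ℝ using (fromℕ)
  open OrderedField ℝ
  open IntegerSolver commutativeRing using (solve; _:+_; _:*_; :-_; _:-_; _:=_)
  open RingProperties ring using (-0#≈0#; -‿distribˡ-*; -‿distribʳ-*)
  private module ∑ = SemiringSum semiring
  open SetoidReasoning setoid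

  private
    variable
      m n : ℕ

  -- Sealing sum keeps the index type of a summand inferable from the sum.
  opaque
    sum : Vector Carrier n → Carrier
    sum = ∑.sum

    sum-unseal : ∀ (g : Vector Carrier n) → sum g ≡ ∑.sum g
    sum-unseal g = ≡.refl

    sum-nil : ∀ {g : Vector Carrier 0} → sum g ≈ 0#
    sum-nil = refl

    sum-cons : ∀ (g : Vector Carrier (suc n)) → sum g ≈ g zero + sum (g ∘ suc)
    sum-cons g = refl

    sum-cong : ∀ {g h : Vector Carrier n} → (∀ i → g i ≈ h i) → sum g ≈ sum h
    sum-cong = ∑.sum-cong-≋

    sum-replicate-zero : ∀ n → sum {n} (λ _ → 0#) ≈ 0#
    sum-replicate-zero = ∑.sum-replicate-zero

    sum-distrib-+ : ∀ (g h : Vector Carrier n) → sum (λ i → g i + h i) ≈ sum g + sum h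
    sum-distrib-+ = ∑.∑-distrib-+

    sum-comm : ∀ (g : Fin m → Fin n → Carrier) →
               sum (λ i → sum (g i)) ≈ sum λ j → sum λ i → g i j
    sum-comm = ∑.∑-comm

    *-distribˡ-sum : ∀ x (g : Vector Carrier n) → x * sum g ≈ sum λ i → x * g i
    *-distribˡ-sum = ∑.*-distribˡ-sum

    *-distribʳ-sum : ∀ x (g : Vector Carrier n) → sum g * x ≈ sum λ i → g i * x
    *-distribʳ-sum = ∑.*-distribʳ-sum

  sum-zero : ∀ {g : Vector Carrier n} → (∀ i → g i ≈ 0#) → sum g ≈ 0#
  sum-zero {n} g≈0 = trans (sum-cong g≈0) (sum-replicate-zero n)

  sum-single : ∀ (g : Vector Carrier n) i → (∀ j → j ≢ i → g j ≈ 0#) → sum g ≈ g i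
  sum-single {suc n} g zero    z = trans (sum-cons g)
    (trans (+-congˡ (sum-zero λ j → z (suc j) λ ())) (+-identityʳ _))
  sum-single {suc n} g (suc i) z = trans (sum-cons g) (trans (+-cong (z zero λ ())
    (sum-single (g ∘ suc) i λ j j≢i → z (suc j) (j≢i ∘ Finₚ.suc-injective))) (+-identityˡ _))

  sum-mono : ∀ {g h : Vector Carrier n} → (∀ i → g i ≤ h i) → sum g ≤ sum h
  sum-mono {zero}  p = ≤-resp (sym sum-nil) (sym sum-nil) ≤.refl
  sum-mono {suc n} p = ≤-resp (sym (sum-cons _)) (sym (sum-cons _)) (+-mono-≤ (p zero) (sum-mono (p ∘ suc)))

  sum-nonneg : ∀ {g : Vector Carrier n} → (∀ i → 0# ≤ g i) → 0# ≤ sum g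
  sum-nonneg {n} p = ≤-resp (sum-replicate-zero n) refl (sum-mono p)

  sum-neg : ∀ (g : Vector Carrier n) → sum (λ i → - g i) ≈ - sum g
  sum-neg g = begin
    sum (λ i → - g i)        ≈⟨ sum-cong (λ i → trans (-‿cong (sym (*-identityˡ (g i)))) (-‿distribˡ-* 1# (g i))) ⟩
    sum (λ i → - 1# * g i)   ≈⟨ sym (*-distribˡ-sum (- 1#) g) ⟩
    - 1# * sum g             ≈⟨ sym (-‿distribˡ-* 1# _) ⟩
    - (1# * sum g)           ≈⟨ -‿cong (*-identityˡ _) ⟩
    - sum g                  ∎

  sum-sub : ∀ (g h : Vector Carrier n) → sum (λ i → g i - h i) ≈ sum g - sum h
  sum-sub g h = trans (sum-distrib-+ g (λ i → - h i)) (+-congˡ (sum-neg h))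

  sum-1 : ∀ n → sum {n} (λ _ → 1#) ≈ fromℕ n
  sum-1 zero    = sum-nil
  sum-1 (suc n) = trans (sum-cons _) (+-congˡ (sum-1 n))

  δ : Fin n → Fin n → Carrier
  δ i j = if does (i Finₚ.≟ j) then 1# else 0#

  δ-≢ : ∀ {i j : Fin n} → i ≢ j → δ i j ≈ 0#
  δ-≢ {i = i} {j} i≢j rewrite dec-false (i Finₚ.≟ j) i≢j = refl

  δ-refl : ∀ (i : Fin n) → δ i i ≈ 1#
  δ-refl i rewrite dec-true (i Finₚ.≟ i) ≡.refl = refl

  sum-δˡ : ∀ (g : Vector Carrier n) i → sum (λ j → δ i j * g j) ≈ g i
  sum-δˡ g i = trans (sum-single _ i λ j j≢i → trans (*-congʳ (δ-≢ (j≢i ∘ ≡.sym))) (zeroˡ _))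
    (trans (*-congʳ (δ-refl i)) (*-identityˡ _))

  sum-δʳ : ∀ (g : Vector Carrier n) i → sum (λ j → g j * δ i j) ≈ g i
  sum-δʳ g i = trans (sum-cong λ j → *-comm (g j) (δ i j)) (sum-δˡ g i)

  infix 7 _∙_
  _∙_ : Vector Carrier n → Vector Carrier n → Carrier
  a ∙ u = sum λ v → a v * u v

  ∙-zeroʳ : ∀ (a : Vector Carrier n) {u} → (∀ v → u v ≈ 0#) → a ∙ u ≈ 0#
  ∙-zeroʳ a z = sum-zero λ v → trans (*-congˡ (z v)) (zeroʳ _)

  ∙-sub : ∀ (a u w : Vector Carrier n) → a ∙ (λ v → u v - w v) ≈ a ∙ u - a ∙ w
  ∙-sub a u w = trans
    (sum-cong λ v → solve 3 (λ a u w → a :* (u :- w) := a :* u :- a :* w) refl (a v) (u v) (w v))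
    (sum-sub _ _)

  ∙-neg : ∀ (a u : Vector Carrier n) → a ∙ (λ v → - u v) ≈ - (a ∙ u)
  ∙-neg a u = trans (sum-cong λ v → sym (-‿distribʳ-* (a v) (u v))) (sum-neg _)

  ∙-+-* : ∀ (a u w : Vector Carrier n) x →
          a ∙ (λ v → u v + x * w v) ≈ a ∙ u + x * (a ∙ w)
  ∙-+-* a u w x = begin
    a ∙ (λ v → u v + x * w v)                        ≈⟨ sum-cong (λ v →
      solve 4 (λ a u w x → a :* (u :+ x :* w) := a :* u :+ x :* (a :* w)) refl (a v) (u v) (w v) x) ⟩
    sum (λ v → a v * u v + x * (a v * w v))          ≈⟨ sum-distrib-+ _ _ ⟩
    a ∙ u + sum (λ v → x * (a v * w v))              ≈⟨ +-congˡ (sym (*-distribˡ-sum x _)) ⟩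
    a ∙ u + x * (a ∙ w)                              ∎

  ∙-sum : ∀ (a : Vector Carrier n) (c : Vector Carrier m) (N : Fin m → Vector Carrier n) →
          a ∙ (λ v → sum λ t → c t * N t v) ≈ sum λ t → c t * (a ∙ N t)
  ∙-sum a c N = begin
    sum (λ v → a v * sum (λ t → c t * N t v))    ≈⟨ sum-cong (λ v → *-distribˡ-sum (a v) _) ⟩
    sum (λ v → sum λ t → a v * (c t * N t v))    ≈⟨ sum-comm (λ v t → a v * (c t * N t v)) ⟩
    sum (λ t → sum λ v → a v * (c t * N t v))    ≈⟨ sum-cong (λ t → sum-cong λ v →
      solve 3 (λ a c N → a :* (c :* N) := c :* (a :* N)) refl (a v) (c t) (N t v)) ⟩
    sum (λ t → sum λ v → c t * (a v * N t v))    ≈⟨ sum-cong (λ t → sym (*-distribˡ-sum (c t) _)) ⟩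
    sum (λ t → c t * (a ∙ N t))                  ∎

  Independent : (S : Subset m) → (Fin m → Vector Carrier n) → Set
  Independent {m} S a = ∀ (c : Vector Carrier m) → (∀ t → t ∉ S → c t ≈ 0#) →
    (∀ v → sum (λ t → c t * a t v) ≈ 0#) → ∀ t → c t ≈ 0#

  -- Extending N by zero outside S lets every sum over S run over all of Fin m.
  record Dual (S : Subset m) (a N : Fin m → Vector Carrier n) : Set where
    field
      outside  : ∀ {t} → t ∉ S → ∀ v → N t v ≈ 0#
      dual     : ∀ {s} t → s ∈ S → a s ∙ N t ≈ δ s t

  -- Rows are adjoined one at a time. By independence the new row differs at some coordinate `v₀`
  -- from the combination of old rows with coefficients `γ`. Projecting that coordinate vector to
  -- the common kernel of the old rows and scaling by `p` gives a dual `η` of the new row; multiples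
  -- of `η` correct the old dual vectors.
  independent⇒dual : ∀ (S : Subset m) (a : Fin m → Vector Carrier n) →
                     Independent S a → ∃ (Dual S a)
  independent⇒dual [] a ind = (λ ()) , record { outside = λ {} ; dual = λ {} }
  independent⇒dual {suc m} {n} (false ∷ S) a ind
    with independent⇒dual S (a ∘ suc) (λ c c∉ c0 t →
           ind (0# Vector.∷ c)
             (λ { zero _ → refl ; (suc t) t∉ → c∉ t (t∉ ∘ there) })
             (λ v → trans (sum-cons _) (trans (+-cong (zeroˡ _) (c0 v)) (+-identityˡ 0#))) (suc t))
  ... | N , N-dual = N⁺ , record { outside = outside⁺ ; dual = dual⁺ }
    where
    open Dual N-dual
    N⁺ : Fin (suc m) → Vector Carrier n
    N⁺ zero    v = 0#
    N⁺ (suc t) v = N t v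
    outside⁺ : ∀ {t} → t ∉ false ∷ S → ∀ v → N⁺ t v ≈ 0#
    outside⁺ {zero}  _  v = refl
    outside⁺ {suc t} t∉ v = outside (t∉ ∘ there) v
    dual⁺ : ∀ {s} t → s ∈ false ∷ S → a s ∙ N⁺ t ≈ δ s t
    dual⁺ {suc s} zero    _         = ∙-zeroʳ (a (suc s)) λ v → refl
    dual⁺ {suc s} (suc t) (there p) = dual t p
  independent⇒dual {suc m} {n} (true ∷ S) a ind
    with independent⇒dual S (a ∘ suc) (λ c c∉ c0 t →
           ind (0# Vector.∷ c)
             (λ { zero 0∉ → contradiction here 0∉ ; (suc t) t∉ → c∉ t (t∉ ∘ there) })
             (λ v → trans (sum-cons _) (trans (+-cong (zeroˡ _) (c0 v)) (+-identityˡ 0#))) (suc t))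
  ... | N , N-dual = N⁺ , record { outside = outside⁺ ; dual = dual⁺ }
    where
    open Dual N-dual
    γ : Vector Carrier m
    γ t = a zero ∙ N t

    γ-outside : ∀ {t} → t ∉ S → γ t ≈ 0#
    γ-outside t∉ = ∙-zeroʳ (a zero) (outside t∉)

    remainder : Vector Carrier n
    remainder v = a zero v - sum λ t → γ t * a (suc t) v

    remainder≉0 : ∃[ v ] ¬ (remainder v ≈ 0#)
    remainder≉0 = Finₚ.¬∀⟶∃¬ n _ (λ v → remainder v ≟ 0#) λ r≈0 → 1≉0 (ind
      (1# Vector.∷ λ t → - γ t)
      (λ { zero 0∉ → contradiction here 0∉
         ; (suc t) t∉ → trans (-‿cong (γ-outside (t∉ ∘ there))) -0#≈0# })
      (λ v → trans (sum-cons _) (trans (+-cong (*-identityˡ _)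
        (trans (sum-cong λ t → sym (-‿distribˡ-* (γ t) _)) (sum-neg _))) (r≈0 v)))
      zero)

    v₀ : Fin n
    v₀ = proj₁ remainder≉0
    p : Carrier
    p = proj₁ (inverse _ (proj₂ remainder≉0))

    projection : Vector Carrier n
    projection v = δ v₀ v - sum λ t → a (suc t) v₀ * N t v
    η : Vector Carrier n
    η v = p * projection v

    ∙-η : ∀ b → b ∙ η ≈ p * (b v₀ - sum λ t → a (suc t) v₀ * (b ∙ N t))
    ∙-η b = begin
      b ∙ η                    ≈⟨ sum-cong (λ v →
        solve 3 (λ b p q → b :* (p :* q) := p :* (b :* q)) refl (b v) p (projection v)) ⟩
      sum (λ v → p * (b v * projection v)) ≈⟨ sym (*-distribˡ-sum p _) ⟩
      p * (b ∙ projection)     ≈⟨ *-congˡ (∙-sub b (δ v₀) _) ⟩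
      p * (b ∙ δ v₀ - b ∙ (λ v → sum λ t → a (suc t) v₀ * N t v))
        ≈⟨ *-congˡ (+-cong (sum-δʳ b v₀) (-‿cong (∙-sum b _ N))) ⟩
      p * (b v₀ - sum λ t → a (suc t) v₀ * (b ∙ N t)) ∎

    a₀∙η : a zero ∙ η ≈ 1#
    a₀∙η = begin
      a zero ∙ η         ≈⟨ ∙-η (a zero) ⟩
      p * (a zero v₀ - sum λ t → a (suc t) v₀ * γ t)
        ≈⟨ *-congˡ (+-congˡ (-‿cong (sum-cong λ t → *-comm _ (γ t)))) ⟩
      p * remainder v₀   ≈⟨ *-comm p _ ⟩
      remainder v₀ * p   ≈⟨ proj₂ (inverse _ (proj₂ remainder≉0)) ⟩
      1#                 ∎

    a∙η : ∀ {s} → s ∈ S → a (suc s) ∙ η ≈ 0#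
    a∙η {s} s∈S = begin
      a (suc s) ∙ η      ≈⟨ ∙-η (a (suc s)) ⟩
      p * (a (suc s) v₀ - sum λ t → a (suc t) v₀ * (a (suc s) ∙ N t))
        ≈⟨ *-congˡ (+-congˡ (-‿cong (sum-cong λ t → *-congˡ (dual t s∈S)))) ⟩
      p * (a (suc s) v₀ - sum λ t → a (suc t) v₀ * δ s t)
        ≈⟨ *-congˡ (+-congˡ (-‿cong (sum-δʳ (λ t → a (suc t) v₀) s))) ⟩
      p * (a (suc s) v₀ - a (suc s) v₀) ≈⟨ *-congˡ (-‿inverseʳ _) ⟩
      p * 0#             ≈⟨ zeroʳ p ⟩
      0#                 ∎

    N⁺ : Fin (suc m) → Vector Carrier n
    N⁺ zero    = η
    N⁺ (suc t) v = N t v + (- γ t) * η v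

    outside⁺ : ∀ {t} → t ∉ true ∷ S → ∀ v → N⁺ t v ≈ 0#
    outside⁺ {zero}  0∉ v = contradiction here 0∉
    outside⁺ {suc t} t∉ v = trans (+-cong (outside (t∉ ∘ there) v)
      (trans (*-congʳ (trans (-‿cong (γ-outside (t∉ ∘ there))) -0#≈0#)) (zeroˡ _))) (+-identityˡ 0#)

    dual⁺ : ∀ {s} t → s ∈ true ∷ S → a s ∙ N⁺ t ≈ δ s t
    dual⁺ {zero}  zero    _           = a₀∙η
    dual⁺ {suc s} zero    (there s∈S) = a∙η s∈S
    dual⁺ {zero}  (suc t) _           = begin
      a zero ∙ N⁺ (suc t)              ≈⟨ ∙-+-* (a zero) (N t) η (- γ t) ⟩
      γ t + (- γ t) * (a zero ∙ η)     ≈⟨ +-congˡ (trans (*-congˡ a₀∙η) (*-identityʳ _)) ⟩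
      γ t - γ t                        ≈⟨ -‿inverseʳ _ ⟩
      0#                               ∎
    dual⁺ {suc s} (suc t) (there s∈S) = begin
      a (suc s) ∙ N⁺ (suc t)              ≈⟨ ∙-+-* (a (suc s)) (N t) η (- γ t) ⟩
      a (suc s) ∙ N t + (- γ t) * (a (suc s) ∙ η)
        ≈⟨ +-cong (dual t s∈S) (trans (*-congˡ (a∙η s∈S)) (zeroʳ _)) ⟩
      δ s t + 0#                       ≈⟨ +-identityʳ _ ⟩
      δ s t                            ∎

  -- Together with `Dual` this makes `N` a two-sided inverse of the rows in `S`, so these rows form
  -- a basis.
  Spanning : (a N : Fin m → Vector Carrier n) → Set
  Spanning a N = ∀ v w → sum (λ t → a t v * N t w) ≈ δ v w

  -- The defect of `Spanning`. Each of its rows lies in the kernel of the rows in `S`, so a nonzero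
  -- one is a direction that keeps tight rows tight.
  residue : (a N : Fin m → Vector Carrier n) → Fin n → Vector Carrier n
  residue a N v w = δ v w - sum λ t → a t v * N t w

  residue-kernel : ∀ {S : Subset m} {a N : Fin m → Vector Carrier n} → Dual S a N →
                   ∀ v {s} → s ∈ S → a s ∙ residue a N v ≈ 0#
  residue-kernel {a = a} {N} D v {s} s∈S = begin
    a s ∙ residue a N v                                ≈⟨ ∙-sub (a s) (δ v) _ ⟩
    a s ∙ δ v - a s ∙ (λ w → sum λ t → a t v * N t w)
      ≈⟨ +-cong (sum-δʳ (a s) v) (-‿cong (∙-sum (a s) _ N)) ⟩
    a s v - sum (λ t → a t v * (a s ∙ N t))
      ≈⟨ +-congˡ (-‿cong (trans (sum-cong λ t → *-congˡ (Dual.dual D t s∈S))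
                                (sum-δʳ (λ t → a t v) s))) ⟩
    a s v - a s v                                      ≈⟨ -‿inverseʳ _ ⟩
    0#                                                 ∎

  residue-zero⇒spanning : ∀ (a N : Fin m → Vector Carrier n) →
                          (∀ v w → residue a N v w ≈ 0#) → Spanning a N
  residue-zero⇒spanning a N z v w = begin
    sum (λ t → a t v * N t w)
      ≈⟨ solve 2 (λ d x → x := d :- (d :- x)) refl (δ v w) (sum (λ t → a t v * N t w)) ⟩
    δ v w - residue a N v w    ≈⟨ +-congˡ (trans (-‿cong (z v w)) -0#≈0#) ⟩
    δ v w + 0#                 ≈⟨ +-identityʳ _ ⟩
    δ v w                      ∎

  -- Apply the matrix identity `Spanning` to `u`: the edge coordinates of a direction are its rates
  -- of change in the constraints.
  expansion : ∀ {a N : Fin m → Vector Carrier n} → Spanning a N →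
              ∀ u w → u w ≈ sum λ t → (a t ∙ u) * N t w
  expansion {a = a} {N} sp u w = begin
    u w                                          ≈⟨ sym (sum-δʳ u w) ⟩
    sum (λ v → u v * δ w v)                      ≈⟨ sum-cong (λ v → *-congˡ (trans (δ-sym w v) (sym (sp v w)))) ⟩
    sum (λ v → u v * sum (λ t → a t v * N t w))  ≈⟨ sum-cong (λ v → *-distribˡ-sum (u v) _) ⟩
    sum (λ v → sum λ t → u v * (a t v * N t w))  ≈⟨ sum-comm (λ v t → u v * (a t v * N t w)) ⟩
    sum (λ t → sum λ v → u v * (a t v * N t w))  ≈⟨ sum-cong (λ t → trans (sum-cong λ v →
      solve 3 (λ u a N → u :* (a :* N) := (a :* u) :* N) refl (u v) (a t v) (N t w))
      (sym (*-distribʳ-sum (N t w) _))) ⟩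
    sum (λ t → (a t ∙ u) * N t w)                ∎
    where
    δ-sym : ∀ (i j : Fin _) → δ i j ≈ δ j i
    δ-sym i j with i Finₚ.≟ j
    ... | yes ≡.refl = sym (δ-refl i)
    ... | no  i≢j    = sym (δ-≢ (i≢j ∘ ≡.sym))

  kernel-trivial : ∀ {S : Subset m} {a N : Fin m → Vector Carrier n} → Dual S a N → Spanning a N →
                   ∀ u → (∀ {t} → t ∈ S → a t ∙ u ≈ 0#) → ∀ v → u v ≈ 0#
  kernel-trivial {S = S} {a} {N} D sp u k v = trans (expansion sp u v) (sum-zero term)
    where
    term : ∀ t → (a t ∙ u) * N t v ≈ 0#
    term t with t ∈? S
    ... | yes t∈S = trans (*-congʳ (k t∈S)) (zeroˡ _)
    ... | no  t∉S = trans (*-congˡ (Dual.outside D t∉S v)) (zeroʳ _)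

  sum-indicator : ∀ (S : Subset m) (g : Vector Carrier m) → (∀ {t} → t ∈ S → g t ≈ 1#) →
                  (∀ {t} → t ∉ S → g t ≈ 0#) → sum g ≈ fromℕ ∣ S ∣
  sum-indicator []          g in1 out0 = sum-nil
  sum-indicator (true ∷ S)  g in1 out0 = trans (sum-cons g)
    (+-cong (in1 here) (sum-indicator S (g ∘ suc) (in1 ∘ there) λ t∉ → out0 (t∉ ∘ drop-there)))
  sum-indicator (false ∷ S) g in1 out0 = trans (sum-cons g) (trans
    (+-cong (out0 λ ()) (sum-indicator S (g ∘ suc) (in1 ∘ there) λ t∉ → out0 (t∉ ∘ drop-there)))
    (+-identityˡ _))

  -- Both sides are the trace of the identity matrix.
  dual-spanning-card : ∀ {S : Subset m} {a N : Fin m → Vector Carrier n} →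
                       Dual S a N → Spanning a N → ∣ S ∣ ≡ n
  dual-spanning-card {m} {n} {S} {a} {N} D sp = fromℕ-injective (begin
    fromℕ ∣ S ∣                        ≈⟨ sym (sum-indicator S _
      (λ {t} t∈S → trans (dual t t∈S) (δ-refl t)) (λ {t} t∉S → ∙-zeroʳ (a t) (outside t∉S))) ⟩
    sum (λ t → a t ∙ N t)              ≈⟨ sum-comm (λ t v → a t v * N t v) ⟩
    sum (λ v → sum λ t → a t v * N t v)  ≈⟨ sum-cong (λ v → trans (sp v v) (δ-refl v)) ⟩
    sum {n} (λ _ → 1#)                 ≈⟨ sum-1 n ⟩
    fromℕ n                            ∎)
    where open Dual D

module LexicographicVectors (ℝ : CompleteOrderedField) where
  open CompleteOrderedField ℝ hiding (zero)
  open OrderedField ℝ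
  open Lexicographic ℝ
  open LinearAlgebra ℝ

  -- This is the shape of every strictness argument below: real parts give a weak inequality and the
  -- infinitesimals break the tie.
  lexPos-cons : ∀ {N} (x : Vector Carrier (suc N)) → 0# ≤ x zero → LexPos (x ∘ suc) → LexPos x
  lexPos-cons x 0≤x p with 0# ≟ x zero
  ... | yes 0≈x = inj₂ (sym 0≈x , p)
  ... | no  0≉x = inj₁ (0≤x , 0≉x)

  lexPos-at : ∀ {N} {x : Vector Carrier N} k → Pos (x k) → (∀ l → l Fin.< k → x l ≈ 0#) → LexPos x
  lexPos-at zero    p z = inj₁ p
  lexPos-at (suc k) p z = inj₂ (z zero ℕ.z<s , lexPos-at k p λ l l<k → z (suc l) (ℕ.s<s l<k))

  lexNonNeg-scale : ∀ {N} {a} {x : Vector Carrier N} → 0# ≤ a → LexNonNeg x → LexNonNeg λ c → x c * a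
  lexNonNeg-scale 0≤a (inj₁ p) = lexNonNeg-* 0≤a p
  lexNonNeg-scale 0≤a (inj₂ z) = inj₂ λ c → trans (*-congʳ (z c)) (zeroˡ _)

  lexNonNeg-sum : ∀ {n N} {x : Fin n → Vector Carrier N} → (∀ v → LexNonNeg (x v)) →
                  LexNonNeg λ c → sum λ v → x v c
  lexNonNeg-sum {zero}  p = inj₂ λ c → sum-nil
  lexNonNeg-sum {suc n} p = lexNonNeg-resp (λ c → sym (sum-cons _))
    (lexNonNeg-+ (p zero) (lexNonNeg-sum (p ∘ suc)))

-- Indicator vectors of subsets

module Indicators (ℝ : CompleteOrderedField) where
  open CompleteOrderedField ℝ hiding (zero)
  open OrderedField ℝ
  open LinearAlgebra ℝ
  open Functions ℝ using (_[_])
  open SetoidReasoning setoid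

  indicator : ∀ {n} → Subset n → Vector Carrier n
  indicator A v = if Vec.lookup A v then 1# else 0#

  indicator-∈ : ∀ {n} {A : Subset n} {v} → v ∈ A → indicator A v ≡ 1#
  indicator-∈ v∈A rewrite Vecₚ.[]=⇒lookup v∈A = ≡.refl

  indicator-∉ : ∀ {n} {A : Subset n} {v} → v ∉ A → indicator A v ≡ 0#
  indicator-∉ {A = A} {v} v∉A with Vec.lookup A v in eq
  ... | true  = contradiction (Vecₚ.lookup⇒[]= v A eq) v∉A
  ... | false = ≡.refl

  indicator-∙ : ∀ {n} (A : Subset n) g → indicator A ∙ g ≈ g [ A ]
  indicator-∙ A g = trans (sum-cong λ v → term (Vec.lookup A v) (g v)) (reflexive (sum-unseal _))
    where
    term : ∀ x y → (if x then 1# else 0#) * y ≈ (if x then y else 0#)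
    term true  y = *-identityˡ y
    term false y = zeroˡ y

  indicator-∪-∩ : ∀ {n} (A B : Subset n) (g : Vector Carrier n) →
    indicator (A ∪ B) ∙ g + indicator (A ∩ B) ∙ g ≈ indicator A ∙ g + indicator B ∙ g
  indicator-∪-∩ A B g = begin
    indicator (A ∪ B) ∙ g + indicator (A ∩ B) ∙ g  ≈⟨ sym (sum-distrib-+ _ _) ⟩
    sum (λ v → indicator (A ∪ B) v * g v + indicator (A ∩ B) v * g v)  ≈⟨ sum-cong term ⟩
    sum (λ v → indicator A v * g v + indicator B v * g v)              ≈⟨ sum-distrib-+ _ _ ⟩
    indicator A ∙ g + indicator B ∙ g  ∎
    where
    cases : ∀ x y z → (if x ∨ y then 1# else 0#) * z + (if x ∧ y then 1# else 0#) * z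
                    ≈ (if x then 1# else 0#) * z + (if y then 1# else 0#) * z
    cases true  true  z = refl
    cases true  false z = refl
    cases false true  z = +-comm _ _
    cases false false z = refl
    term : ∀ v → indicator (A ∪ B) v * g v + indicator (A ∩ B) v * g v
               ≈ indicator A v * g v + indicator B v * g v
    term v rewrite Vecₚ.lookup-zipWith _∨_ v A B | Vecₚ.lookup-zipWith _∧_ v A B =
      cases (Vec.lookup A v) (Vec.lookup B v) (g v)

  indicator-⁅⁆ : ∀ {n} (v : Fin n) g → indicator ⁅ v ⁆ ∙ g ≈ g v
  indicator-⁅⁆ v g = trans (sum-single _ v λ w w≢v →
    trans (*-congʳ (reflexive (indicator-∉ (w≢v ∘ x∈⁅y⁆⇒x≡y v)))) (zeroˡ _))
    (trans (*-congʳ (reflexive (indicator-∈ (x∈⁅x⁆ v)))) (*-identityˡ _))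

  indicator-mono : ∀ {n} {A B : Subset n} → A ⊆ B → ∀ v → indicator A v ≤ indicator B v
  indicator-mono {A = A} {B} A⊆B v with v ∈? A | v ∈? B
  ... | yes v∈A | yes v∈B = ≤.reflexive (reflexive (≡.trans (indicator-∈ v∈A) (≡.sym (indicator-∈ v∈B))))
  ... | yes v∈A | no  v∉B = contradiction (A⊆B v∈A) v∉B
  ... | no  v∉A | yes v∈B = ≤-resp (reflexive (≡.sym (indicator-∉ v∉A)))
    (reflexive (≡.sym (indicator-∈ v∈B))) (proj₁ pos-1)
  ... | no  v∉A | no  v∉B = ≤.reflexive (reflexive (≡.trans (indicator-∉ v∉A) (≡.sym (indicator-∉ v∉B))))

-- The simplex method with lexicographic right-hand sides

module MinimumRatio (ℝ : CompleteOrderedField) where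
  open CompleteOrderedField ℝ hiding (zero)
  open OrderedField ℝ
  open Lexicographic ℝ
  open IntegerSolver commutativeRing using (solve; _:+_; _:*_; :-_; _:-_; _:=_)

  -- The ratio test without quotients: `s t c - ratio c * α t` is the slack that row `t` has left
  -- after a step of length `ratio` in a direction with rates `α`.
  record MinRatio {m N} (s : Fin m → Vector Carrier N) (α : Vector Carrier m) : Set where
    field
      ratio     : Vector Carrier N
      ratio-pos : LexPos ratio
      argmin    : Fin m
      argmin-pos : Pos (α argmin)
      attained  : Zero λ c → s argmin c - ratio c * α argmin
      minimal   : ∀ t → Pos (α t) → LexNonNeg λ c → s t c - ratio c * α t

  minRatio : ∀ {m N} (s : Fin m → Vector Carrier N) (α : Vector Carrier m) →
             (∀ t → Pos (α t) → LexPos (s t)) → (∀ t → ¬ Pos (α t)) ⊎ MinRatio s α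
  minRatio {zero} s α s-pos = inj₁ λ ()
  minRatio {suc m} {N} s α s-pos
    with pos? (α zero) | minRatio (s ∘ suc) (α ∘ suc) (s-pos ∘ suc)
  ... | no ¬p | inj₁ none = inj₁ λ { zero → ¬p ; (suc t) → none t }
  ... | no ¬p | inj₂ r = inj₂ record
    { ratio = ratio ; ratio-pos = ratio-pos ; argmin = suc argmin
    ; argmin-pos = argmin-pos ; attained = attained
    ; minimal = λ { zero p → contradiction p ¬p ; (suc t) → minimal t } }
    where open MinRatio r
  ... | yes p | rest with pos-inverse p
  ... | β , β-pos , αβ≈1 = head-or-tail rest
    where
    ρ : Vector Carrier N
    ρ c = s zero c * β

    ρ-pos : LexPos ρ
    ρ-pos = lexPos-* β-pos (s-pos zero p)

    ρα≈s : ∀ c → ρ c * α zero ≈ s zero c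
    ρα≈s c = trans (solve 3 (λ s b a → (s :* b) :* a := s :* (a :* b)) refl (s zero c) β (α zero))
      (trans (*-congˡ αβ≈1) (*-identityʳ _))

    ρ-attained : Zero λ c → s zero c - ρ c * α zero
    ρ-attained c = trans (+-congˡ (-‿cong (ρα≈s c))) (-‿inverseʳ _)

    head-or-tail : (∀ t → ¬ Pos (α (suc t))) ⊎ MinRatio (s ∘ suc) (α ∘ suc) →
                   (∀ t → ¬ Pos (α t)) ⊎ MinRatio s α
    head-or-tail (inj₁ none) = inj₂ record
      { ratio = ρ ; ratio-pos = ρ-pos ; argmin = zero ; argmin-pos = p ; attained = ρ-attained
      ; minimal = λ { zero _ → inj₂ ρ-attained ; (suc t) q → contradiction q (none t) } }
    head-or-tail (inj₂ r) with lexSign (λ c → s zero c - MinRatio.ratio r c * α zero)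
    ... | pos q = inj₂ record
      { ratio = ratio ; ratio-pos = ratio-pos ; argmin = suc argmin
      ; argmin-pos = argmin-pos ; attained = attained
      ; minimal = λ { zero _ → inj₁ q ; (suc t) → minimal t } }
      where open MinRatio r
    ... | nil q = inj₂ record
      { ratio = ratio ; ratio-pos = ratio-pos ; argmin = suc argmin
      ; argmin-pos = argmin-pos ; attained = attained
      ; minimal = λ { zero _ → inj₂ q ; (suc t) → minimal t } }
      where open MinRatio r
    ... | neg q = inj₂ record
      { ratio = ρ ; ratio-pos = ρ-pos ; argmin = zero ; argmin-pos = p ; attained = ρ-attained
      ; minimal = λ { zero _ → inj₂ ρ-attained ; (suc t) → ρ-minimal t } }
      where
      open MinRatio r
      -- At the old ratio the head row has negative slack; multiply it by `β`, the inverse of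
      -- `α zero`.
      ρ<ratio : LexPos λ c → ratio c - ρ c
      ρ<ratio = lexPos-resp
        (λ c → trans (solve 4 (λ s a b r → :- (s :- r :* a) :* b := r :* (a :* b) :- s :* b) refl
                 (s zero c) (α zero) β (ratio c))
               (+-congʳ (trans (*-congˡ αβ≈1) (*-identityʳ _))))
        (lexPos-* β-pos q)
      ρ-minimal : ∀ t → Pos (α (suc t)) → LexNonNeg λ c → s (suc t) c - ρ c * α (suc t)
      ρ-minimal t p′ = lexNonNeg-resp
        (λ c → solve 4 (λ s r ρ a → (s :- r :* a) :+ (r :- ρ) :* a := s :- ρ :* a) refl
                 (s (suc t) c) (ratio c) (ρ c) (α (suc t)))
        (lexNonNeg-+ (minimal t p′) (inj₁ (lexPos-* p′ ρ<ratio)))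

module LinearProgramming (ℝ : CompleteOrderedField) where
  open CompleteOrderedField ℝ hiding (zero)
  open OrderedField ℝ
  open Lexicographic ℝ
  open LinearAlgebra ℝ
  open MinimumRatio ℝ
  open IntegerSolver commutativeRing using (solve; _:+_; _:*_; :-_; _:-_; _:=_)
  open RingProperties ring using (-0#≈0#)
  open SetoidReasoning setoid

  -- The programme maximises the coordinate sum of f subject to a t ∙ f ≤ b t,
  -- where the right-hand sides and the entries of f are lexicographically
  -- ordered vectors while the matrix a is real.
  module LinearProgram {n m N : ℕ} (a : Fin m → Vector Carrier n) (b : Fin m → Vector Carrier N)
    (bounded : ∀ u → (∀ t → ¬ Pos (a t ∙ u)) → ∀ v → u v ≈ 0#)
    (rows-independent : ∀ (c : Vector Carrier m) → (∀ v → sum (λ t → c t * a t v) ≈ 0#) →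
      (∀ k → sum (λ t → c t * b t k) ≈ 0#) → ∀ t → c t ≈ 0#)
    where

    Point : Set
    Point = Fin n → Vector Carrier N

    slack : Point → Fin m → Vector Carrier N
    slack f t c = b t c - a t ∙ λ v → f v c

    Feasible : Point → Set
    Feasible f = ∀ t → LexNonNeg (slack f t)

    zero? : ∀ (x : Vector Carrier N) → Dec (Zero x)
    zero? x = Finₚ.all? λ c → x c ≟ 0#

    tight : Point → Subset m
    tight f = Vec.tabulate λ t → does (zero? (slack f t))

    zero⇒tight : ∀ f {t} → Zero (slack f t) → t ∈ tight f
    zero⇒tight f {t} z = Vecₚ.lookup⇒[]= t (tight f)
      (≡.trans (Vecₚ.lookup∘tabulate _ t) (dec-true (zero? (slack f t)) z))

    tight⇒zero : ∀ f {t} → t ∈ tight f → Zero (slack f t)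
    tight⇒zero f {t} t∈ with zero? (slack f t) in eq
    ... | yes z = z
    ... | no  _ = contradiction (≡.trans (≡.sym (≡.cong does eq))
      (≡.trans (≡.sym (Vecₚ.lookup∘tabulate _ t)) (Vecₚ.[]=⇒lookup t∈))) λ ()

    tight⇒≈ : ∀ f {t} → t ∈ tight f → ∀ c → a t ∙ (λ v → f v c) ≈ b t c
    tight⇒≈ f {t} t∈ c = trans
      (solve 2 (λ b x → x := b :- (b :- x)) refl (b t c) _)
      (trans (+-congˡ (trans (-‿cong (tight⇒zero f t∈ c)) -0#≈0#)) (+-identityʳ _))

    value : Point → Vector Carrier N
    value f c = sum λ v → f v c

    -- The direction is real and only the step length is lexicographic, so the sign of a rate
    -- `a t ∙ u` is decided in the field.
    shift : Point → Vector Carrier N → Vector Carrier n → Point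
    shift f τ u v c = f v c + τ c * u v

    slack-shift : ∀ f τ u t c → slack (shift f τ u) t c ≈ slack f t c - τ c * (a t ∙ u)
    slack-shift f τ u t c = trans (+-congˡ (-‿cong (∙-+-* (a t) (λ v → f v c) u (τ c))))
      (solve 3 (λ b x y → b :- (x :+ y) := (b :- x) :- y) refl (b t c) _ _)

    value-shift : ∀ f τ u c → value (shift f τ u) c - value f c ≈ τ c * sum u
    value-shift f τ u c = begin
      value (shift f τ u) c - value f c
        ≈⟨ +-congʳ (trans (sum-distrib-+ _ _) (+-congˡ (sym (*-distribˡ-sum (τ c) u)))) ⟩
      (value f c + τ c * sum u) - value f c
        ≈⟨ solve 2 (λ x y → (x :+ y) :- x := y) refl (value f c) _ ⟩
      τ c * sum u ∎

    tight-shift : ∀ f τ u {t} → t ∈ tight f → a t ∙ u ≈ 0# → t ∈ tight (shift f τ u)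
    tight-shift f τ u {t} t∈ au≈0 = zero⇒tight (shift f τ u) λ c → begin
      slack (shift f τ u) t c           ≈⟨ slack-shift f τ u t c ⟩
      slack f t c - τ c * (a t ∙ u)     ≈⟨ +-cong (tight⇒zero f t∈ c)
                                            (-‿cong (trans (*-congˡ au≈0) (zeroʳ _))) ⟩
      0# - 0#                           ≈⟨ -‿inverseʳ 0# ⟩
      0#                                ∎

    record Move (f : Point) (u : Vector Carrier n) : Set where
      field
        τ        : Vector Carrier N
        τ-pos    : LexPos τ
        feasible : Feasible (shift f τ u)
        new      : Fin m
        new∉     : new ∉ tight f
        new∈     : new ∈ tight (shift f τ u)

    -- Some row has a positive rate, since otherwise `bounded` forces `u` to vanish. No tight row
    -- has one, so the slacks that limit the step are strictly positive, and so is the step.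
    move : ∀ f u → Feasible f → (∀ {t} → t ∈ tight f → ¬ Pos (a t ∙ u)) →
           ∀ {v} → ¬ (u v ≈ 0#) → Move f u
    move f u feas blocked {v} uv≉0 with minRatio (slack f) (λ t → a t ∙ u) slack-pos
      where
      slack-pos : ∀ t → Pos (a t ∙ u) → LexPos (slack f t)
      slack-pos t p with feas t
      ... | inj₁ q = q
      ... | inj₂ z = contradiction p (blocked (zero⇒tight f z))
    ... | inj₁ none = contradiction (bounded u none v) uv≉0
    ... | inj₂ r = record
      { τ = ratio ; τ-pos = ratio-pos ; feasible = feasible ; new = argmin
      ; new∉ = λ t∈ → blocked t∈ argmin-pos
      ; new∈ = zero⇒tight (shift f ratio u) λ c →
          trans (slack-shift f ratio u argmin c) (attained c) }
      where
      open MinRatio r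
      feasible : Feasible (shift f ratio u)
      feasible t with pos? (a t ∙ u)
      ... | yes p = lexNonNeg-resp (λ c → sym (slack-shift f ratio u t c)) (minimal t p)
      ... | no ¬p = lexNonNeg-resp
        (λ c → trans (solve 3 (λ s r a → s :+ r :* :- a := s :- r :* a) refl (slack f t c) (ratio c) _)
                     (sym (slack-shift f ratio u t c)))
        (lexNonNeg-+ (feas t) (lexNonNeg-* (nonpos⇒neg-nonneg (¬pos⇒≤0 ¬p)) ratio-pos))

    -- On tight rows the right-hand side is `a t` applied to `f`, so a relation among these rows of
    -- `a` also holds among their right-hand sides, and `rows-independent` makes it trivial.
    tight-independent : ∀ f → Independent (tight f) a
    tight-independent f c c∉ ca≈0 = rows-independent c ca≈0 λ k → begin
      sum (λ t → c t * b t k)                    ≈⟨ sum-cong (term k) ⟩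
      sum (λ t → c t * (a t ∙ λ v → f v k))      ≈⟨ sum-cong (λ t → trans (*-comm _ _) (*-distribʳ-sum (c t) _)) ⟩
      sum (λ t → sum λ v → a t v * f v k * c t)  ≈⟨ sum-comm _ ⟩
      sum (λ v → sum λ t → a t v * f v k * c t)  ≈⟨ sum-zero (λ v → trans (sum-cong λ t →
        solve 3 (λ a f c → a :* f :* c := (c :* a) :* f) refl (a t v) (f v k) (c t))
        (trans (sym (*-distribʳ-sum (f v k) _)) (trans (*-congʳ (ca≈0 v)) (zeroˡ _)))) ⟩
      0#                                         ∎
      where
      term : ∀ k t → c t * b t k ≈ c t * (a t ∙ λ v → f v k)
      term k t with t ∈? tight f
      ... | yes t∈ = *-congˡ (sym (tight⇒≈ f t∈ k))
      ... | no  t∉ = trans (*-congʳ (c∉ t t∉)) (trans (zeroˡ _)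
                       (sym (trans (*-congʳ (c∉ t t∉)) (zeroˡ _))))

    -- For tight `t`, moving along `edges t` raises row `t` at unit rate and fixes the other tight
    -- rows; the opposite direction releases the constraint.
    record Vertex (f : Point) : Set where
      field
        feasible : Feasible f
        edges    : Fin m → Vector Carrier n
        dual     : Dual (tight f) a edges
        spanning : Spanning a edges

    infix 4 _≼_ _≺_
    _≼_ _≺_ : Point → Point → Set
    f ≼ g = LexNonNeg λ c → value g c - value f c
    f ≺ g = LexPos λ c → value g c - value f c

    ≼-refl : ∀ {f} → f ≼ f
    ≼-refl = inj₂ λ c → -‿inverseʳ _

    private
      telescope : ∀ f g h c → (value g c - value f c) + (value h c - value g c) ≈ value h c - value f c
      telescope f g h c = solve 3 (λ x y z → (y :- x) :+ (z :- y) := z :- x) refl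
        (value f c) (value g c) (value h c)

    ≼-trans : ∀ {f g h} → f ≼ g → g ≼ h → f ≼ h
    ≼-trans {f} {g} {h} p q = lexNonNeg-resp (telescope f g h) (lexNonNeg-+ p q)

    ≺-≼-trans : ∀ {f g h} → f ≺ g → g ≼ h → f ≺ h
    ≺-≼-trans {f} {g} {h} p q = lexPos-resp (telescope f g h) (lexPos-+-nonNeg p q)

    -- A nonzero `residue` can be followed both ways, so one choice of sign does not lower the
    -- value. Each move keeps the old tight rows and gains a new one.
    purify : ∀ f → Feasible f → ∃[ g ] Vertex g × tight f ⊆ tight g × f ≼ g
    purify f feas = go f feas (<-wellFounded _)
      where
      go : ∀ f → Feasible f → Acc ℕ._<_ (m ℕ.∸ ∣ tight f ∣) →
           ∃[ g ] Vertex g × tight f ⊆ tight g × f ≼ g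
      go f feas (acc rec) with independent⇒dual (tight f) a (tight-independent f)
      ... | E , D with Finₚ.all? (λ v → Finₚ.all? λ w → residue a E v w ≟ 0#)
      ... | yes z = f , record { feasible = feas ; edges = E ; dual = D
                               ; spanning = residue-zero⇒spanning a E z } , (λ t∈ → t∈) , ≼-refl {f}
      ... | no ¬z with Finₚ.¬∀⟶∃¬ n _ (λ v → Finₚ.all? λ w → residue a E v w ≟ 0#) ¬z
      ... | v , ¬zv with Finₚ.¬∀⟶∃¬ n _ (λ w → residue a E v w ≟ 0#) ¬zv
      ... | w , rw≉0 = choose (0# ≤? sum r)
        where
        r : Vector Carrier n
        r = residue a E v

        along : ∀ u → (∀ {t} → t ∈ tight f → a t ∙ u ≈ 0#) → ¬ (u w ≈ 0#) → 0# ≤ sum u →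
                ∃[ g ] Vertex g × tight f ⊆ tight g × f ≼ g
        along u kernel uw≉0 gain
          with move f u feas (λ t∈ p → pos⇒≉0 p (kernel t∈)) uw≉0
        ... | M with go (shift f (Move.τ M) u) (Move.feasible M)
                       (rec (ℕₚ.∸-monoʳ-< (p⊂q⇒∣p∣<∣q∣
                         ((λ t∈ → tight-shift f (Move.τ M) u t∈ (kernel t∈)) ,
                          Move.new M , Move.new∈ M , Move.new∉ M)) (∣p∣≤n (tight (shift f (Move.τ M) u)))))
        ... | g , vertex , ⊆g , ≼g = g , vertex , (λ t∈ → ⊆g (tight-shift f (Move.τ M) u t∈ (kernel t∈))) ,
          ≼-trans {f} {shift f (Move.τ M) u} {g} (lexNonNeg-resp (λ c → sym (value-shift f (Move.τ M) u c))
            (lexNonNeg-* gain (Move.τ-pos M))) ≼g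

        choose : Dec (0# ≤ sum r) → ∃[ g ] Vertex g × tight f ⊆ tight g × f ≼ g
        choose (yes 0≤) = along r (residue-kernel D v) rw≉0 0≤
        choose (no ¬0≤) = along (λ w → - r w)
          (λ {t} t∈ → trans (∙-neg (a t) r) (trans (-‿cong (residue-kernel D v t∈)) -0#≈0#))
          (λ z → rw≉0 (trans (solve 1 (λ x → x := :- :- x) refl (r w)) (trans (-‿cong z) -0#≈0#)))
          (≤-resp refl (sym (sum-neg r)) (nonpos⇒neg-nonneg (¬pos⇒≤0 λ p → ¬0≤ (proj₁ p))))

    -- Following the negative edge frees row `t` alone; `purify` then supplies the edges of the new
    -- vertex and only adds tight rows.
    improve : ∀ {f} (V : Vertex f) {t} → t ∈ tight f → Pos (- sum (Vertex.edges V t)) →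
              ∃[ g ] Vertex g × f ≺ g × (∀ {s} → s ∈ tight f → s ≢ t → s ∈ tight g)
    improve {f} V {t} t∈ gain = after (move f u feasible blocked (proj₂ nonzero))
      where
      open Vertex V
      u : Vector Carrier n
      u v = - edges t v

      a∙u : ∀ {s} → s ∈ tight f → a s ∙ u ≈ - δ s t
      a∙u {s} s∈ = trans (∙-neg (a s) (edges t)) (-‿cong (Dual.dual dual t s∈))

      a∙u≈0 : ∀ {s} → s ∈ tight f → s ≢ t → a s ∙ u ≈ 0#
      a∙u≈0 s∈ s≢t = trans (a∙u s∈) (trans (-‿cong (δ-≢ s≢t)) -0#≈0#)

      blocked : ∀ {s} → s ∈ tight f → ¬ Pos (a s ∙ u)
      blocked {s} s∈ p with s Finₚ.≟ t
      ... | no  s≢t    = pos⇒≉0 p (a∙u≈0 s∈ s≢t)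
      ... | yes ≡.refl = pos-asym pos-1 (pos-resp (trans (a∙u s∈) (-‿cong (δ-refl t))) p)

      sum-u : sum u ≈ - sum (edges t)
      sum-u = sum-neg (edges t)

      nonzero : ∃[ v ] ¬ (u v ≈ 0#)
      nonzero = Finₚ.¬∀⟶∃¬ n _ (λ v → u v ≟ 0#) λ z → pos⇒≉0 gain (trans (sym sum-u) (sum-zero z))

      after : Move f u → ∃[ g ] Vertex g × f ≺ g × (∀ {s} → s ∈ tight f → s ≢ t → s ∈ tight g)
      after M with purify (shift f (Move.τ M) u) (Move.feasible M)
      ... | g , vertex , ⊆g , ≼g = g , vertex ,
        ≺-≼-trans {f} {shift f (Move.τ M) u} {g}
          (lexPos-resp (λ c → trans (*-congˡ (sym sum-u)) (sym (value-shift f (Move.τ M) u c)))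
            (lexPos-* gain (Move.τ-pos M))) ≼g ,
        λ s∈ s≢t → ⊆g (tight-shift f (Move.τ M) u s∈ (a∙u≈0 s∈ s≢t))

    -- The difference of two points with the same tight rows lies in the kernel of these rows, which
    -- is trivial at a vertex.
    tight-determines-value : ∀ {f g} → Vertex f → tight f ≡ tight g → ∀ c → value f c ≈ value g c
    tight-determines-value {f} {g} V eq c = sum-cong λ v → trans
      (solve 2 (λ x y → x := (x :- y) :+ y) refl (f v c) (g v c))
      (trans (+-congʳ (kernel-trivial dual spanning (λ v → f v c - g v c) kernel v)) (+-identityˡ _))
      where
      open Vertex V
      kernel : ∀ {t} → t ∈ tight f → a t ∙ (λ v → f v c - g v c) ≈ 0#
      kernel {t} t∈ = trans (∙-sub (a t) _ _) (trans (+-cong (tight⇒≈ f t∈ c)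
        (-‿cong (tight⇒≈ g (≡.subst (t ∈_) eq t∈) c))) (-‿inverseʳ _))

    -- A vertex of larger value has a tight set not met before, so the climb stops.
    climb : ∀ {Good : Point → Set} {Done : Set} →
            (∀ f → Vertex f → Good f → Done ⊎ ∃[ g ] Vertex g × Good g × f ≺ g) →
            ∀ f → Vertex f → Good f → Done
    climb {Good} {Done} step f V good =
      go (allSubsets m) f V good (λ g _ _ → ∈-allSubsets (tight g)) (<-wellFounded _)
      where
      go : ∀ l f → Vertex f → Good f → (∀ g → Vertex g → f ≼ g → tight g ∈ₗ l) →
           Acc ℕ._<_ (length l) → Done
      go l f V good remaining (acc rec) with step f V good
      ... | inj₁ done = done
      ... | inj₂ (g , W , good′ , f≺g) =
        go (filter other? l) g W good′ remaining′
          (rec (filter-notAll other? l (Any.map (λ eq ne → ne (≡.sym eq)) (remaining f V (≼-refl {f})))))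
        where
        other? : ∀ S → Dec (S ≢ tight f)
        other? S = ¬? (Vecₚ.≡-dec Boolₚ._≟_ S (tight f))
        remaining′ : ∀ h → Vertex h → g ≼ h → tight h ∈ₗ filter other? l
        remaining′ h X g≼h = ∈-filter⁺ other? (remaining h X (inj₁ f≺h)) λ eq →
          lexPos⇒¬zero f≺h λ c → trans (+-congʳ (tight-determines-value X eq c)) (-‿inverseʳ _)
          where
          f≺h : f ≺ h
          f≺h = ≺-≼-trans {f} {g} {h} f≺g g≼h

-- The perturbed intersection of matroid polytopes

-- Nonnegativity is not perturbed; the bound of A in the i-th matroid becomes
-- max(1, rk A) minus an infinitesimal of its own, which dominates those of the
-- subsets of A.  This makes the bounds strictly submodular and generic.
module PerturbedPolytope (ℝ : CompleteOrderedField) {r n : ℕ} (M : Fin r → Matroid n) (i₀ : Fin r) where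
  open CompleteOrderedField ℝ hiding (zero)
  open Ceiling ℝ using (fromℕ)
  open OrderedField ℝ
  open Lexicographic ℝ
  open LexicographicVectors ℝ
  open LinearAlgebra ℝ
  open Indicators ℝ
  open IntegerSolver commutativeRing using (solve; _:+_; _:*_; :-_; _:-_; _:=_)
  open RingProperties ring using (-0#≈0#; -‿involutive; -‿distribˡ-*)
  open SetoidReasoning setoid

  q : ℕ
  q = r ℕ.* 2 ℕ.^ n

  nonneg-row : Fin n → Fin (n ℕ.+ q)
  nonneg-row v = v ↑ˡ q

  code : Fin r → Subset n → Fin q
  code i A = combine i (encode A)

  bound-row : Fin r → Subset n → Fin (n ℕ.+ q)
  bound-row i A = n ↑ʳ code i A

  data Row : Fin (n ℕ.+ q) → Set where
    nonneg : ∀ v → Row (nonneg-row v)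
    bound  : ∀ i A → Row (bound-row i A)

  row : ∀ t → Row t
  row t with splitAt n t in eq
  ... | inj₁ v = ≡.subst Row (Finₚ.splitAt⁻¹-↑ˡ eq) (nonneg v)
  ... | inj₂ s with Finₚ.combine-surjective {r} {2 ℕ.^ n} s
  ...   | i , l , combine≡s with encode-surjective {n} l
  ...     | A , ≡.refl = ≡.subst Row
            (≡.trans (≡.cong (n ↑ʳ_) combine≡s) (Finₚ.splitAt⁻¹-↑ʳ eq)) (bound i A)

  rk : Fin r → Subset n → ℕ
  rk i = rank (M i)

  coefficient : ∀ {t} → Row t → Vector Carrier n
  coefficient (nonneg v)  w = - δ v w
  coefficient (bound i A) w = indicator A w

  -- Coordinate `code i A` carries the infinitesimal of this bound, and smaller codes come earlier,
  -- hence dominate. The maximum with 1 keeps the bound positive in rank 0, so that the origin is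
  -- feasible.
  limit : ∀ {t} → Row t → Vector Carrier (suc q)
  limit (nonneg v)  c       = 0#
  limit (bound i A) zero    = fromℕ (1 ℕ.⊔ rk i A)
  limit (bound i A) (suc k) = - δ (code i A) k

  a : Fin (n ℕ.+ q) → Vector Carrier n
  a t = coefficient (row t)

  b : Fin (n ℕ.+ q) → Vector Carrier (suc q)
  b t = limit (row t)

  disjoint : ∀ {v s} → v ↑ˡ q ≢ n ↑ʳ s
  disjoint {v} {s} eq with ≡.trans (≡.sym (Finₚ.splitAt-↑ˡ n v q))
      (≡.trans (≡.cong (splitAt n) eq) (Finₚ.splitAt-↑ʳ n q s))
  ... | ()

  bound-row-injective : ∀ {i j A B} → bound-row i A ≡ bound-row j B → i ≡ j × A ≡ B
  bound-row-injective {i} {j} {A} {B} eq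
    with Finₚ.combine-injective i (encode A) j (encode B) (Finₚ.↑ʳ-injective n _ _ eq)
  ... | i≡j , eq′ = i≡j , encode-injective eq′

  -- `a` and `b` are computed from the view `row t`; this lets any view of `t` at hand stand in for
  -- it.
  row-irrelevant : ∀ {t} (x y : Row t) → x ≡ y
  row-irrelevant x y = helper x y ≡.refl
    where
    helper : ∀ {s t} (x : Row s) (y : Row t) (eq : s ≡ t) → ≡.subst Row eq x ≡ y
    helper (nonneg v) (nonneg w) eq with Finₚ.↑ˡ-injective q v w eq
    helper (nonneg v) (nonneg w) ≡.refl | ≡.refl = ≡.refl
    helper (nonneg v)  (bound j B) eq = contradiction eq disjoint
    helper (bound i A) (nonneg w)  eq = contradiction (≡.sym eq) disjoint
    helper (bound i A) (bound j B) eq with bound-row-injective {i} {j} {A} {B} eq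
    helper (bound i A) (bound j B) ≡.refl | ≡.refl , ≡.refl = ≡.refl

  a-row : ∀ {t} (x : Row t) → a t ≡ coefficient x
  a-row x = ≡.cong coefficient (row-irrelevant (row _) x)

  b-row : ∀ {t} (x : Row t) → b t ≡ limit x
  b-row x = ≡.cong limit (row-irrelevant (row _) x)

  nonneg-∙ : ∀ v u → a (nonneg-row v) ∙ u ≈ - u v
  nonneg-∙ v u rewrite a-row (nonneg v) = begin
    sum (λ w → - δ v w * u w)    ≈⟨ sum-cong (λ w → sym (-‿distribˡ-* (δ v w) (u w))) ⟩
    sum (λ w → - (δ v w * u w))  ≈⟨ sum-neg _ ⟩
    - sum (λ w → δ v w * u w)    ≈⟨ -‿cong (sum-δˡ u v) ⟩
    - u v                        ∎

  bound-∙ : ∀ i A u → a (bound-row i A) ∙ u ≡ indicator A ∙ u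
  bound-∙ i A u = ≡.cong (_∙ u) (a-row (bound i A))

  -- The row of `v` forbids `u v` to be negative, and the row of the singleton in the matroid `i₀`
  -- forbids it to be positive.
  bounded : ∀ u → (∀ t → ¬ Pos (a t ∙ u)) → ∀ v → u v ≈ 0#
  bounded u ¬pos v with sign (u v)
  ... | nil z = z
  ... | neg p = contradiction (pos-resp (sym (nonneg-∙ v u)) p) (¬pos (nonneg-row v))
  ... | pos p = contradiction (pos-resp (sym (trans (reflexive (bound-∙ i₀ ⁅ v ⁆ u)) (indicator-⁅⁆ v u))) p)
                  (¬pos (bound-row i₀ ⁅ v ⁆))

  private
    *-neg-one : ∀ {x y} → y ≈ 1# → x * - y ≈ 0# → x ≈ 0#
    *-neg-one {x} {y} y≈1 xy≈0 = begin
      x             ≈⟨ sym (*-identityʳ x) ⟩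
      x * 1#        ≈⟨ *-congˡ (sym y≈1) ⟩
      x * y         ≈⟨ solve 2 (λ x y → x :* y := :- (x :* :- y)) refl x y ⟩
      - (x * - y)   ≈⟨ trans (-‿cong xy≈0) -0#≈0# ⟩
      0#            ∎

    *-neg-zero : ∀ {x y} → y ≈ 0# → x * - y ≈ 0#
    *-neg-zero y≈0 = trans (*-congˡ (trans (-‿cong y≈0) -0#≈0#)) (zeroʳ _)

  -- The coordinate of an infinitesimal is nonzero in a single bound row, so the coefficient of that
  -- row vanishes; the rows that remain form minus the identity.
  rows-independent : ∀ (c : Vector Carrier (n ℕ.+ q)) → (∀ v → sum (λ t → c t * a t v) ≈ 0#) →
    (∀ k → sum (λ t → c t * b t k) ≈ 0#) → ∀ t → c t ≈ 0#
  rows-independent c ca≈0 cb≈0 t = by-row (row t)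
    where
    bound-case : ∀ i A → c (bound-row i A) ≈ 0#
    bound-case i A = *-neg-one (δ-refl (code i A)) (begin
      c s * - δ (code i A) (code i A)     ≡⟨ ≡.cong (λ l → c s * l (suc (code i A))) (b-row (bound i A)) ⟨
      c s * b s (suc (code i A))          ≈⟨ sym (sum-single _ s λ t t≢s → term t (row t) t≢s) ⟩
      sum (λ t → c t * b t (suc (code i A))) ≈⟨ cb≈0 (suc (code i A)) ⟩
      0#                                  ∎)
      where
      s : Fin (n ℕ.+ q)
      s = bound-row i A
      term : ∀ t (x : Row t) → t ≢ s → c t * b t (suc (code i A)) ≈ 0#
      term t x t≢s rewrite b-row x with x
      ... | nonneg v  = zeroʳ _
      ... | bound j B = *-neg-zero (δ-≢ (t≢s ∘ ≡.cong (n ↑ʳ_)))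

    by-row : ∀ {t} → Row t → c t ≈ 0#
    by-row (bound i A) = bound-case i A
    by-row (nonneg v)  = *-neg-one (δ-refl v) (begin
      c s * - δ v v                ≡⟨ ≡.cong (λ l → c s * l v) (a-row (nonneg v)) ⟨
      c s * a s v                  ≈⟨ sym (sum-single _ s λ t t≢s → term t (row t) t≢s) ⟩
      sum (λ t → c t * a t v)      ≈⟨ ca≈0 v ⟩
      0#                           ∎)
      where
      s : Fin (n ℕ.+ q)
      s = nonneg-row v
      term : ∀ t (x : Row t) → t ≢ s → c t * a t v ≈ 0#
      term t x t≢s rewrite a-row x with x
      ... | nonneg w  = *-neg-zero (δ-≢ (t≢s ∘ ≡.cong (_↑ˡ q)))
      ... | bound j B = trans (*-congʳ (bound-case j B)) (zeroˡ _)

  open LinearProgramming ℝ using (module LinearProgram)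
  open LinearProgram a b bounded rows-independent public

  infix 8 _⟦_⟧
  _⟦_⟧ : Point → Subset n → Vector Carrier (suc q)
  (g ⟦ A ⟧) c = indicator A ∙ λ v → g v c

  slack-nonneg : ∀ g v c → slack g (nonneg-row v) c ≈ g v c
  slack-nonneg g v c = begin
    b (nonneg-row v) c - a (nonneg-row v) ∙ (λ w → g w c)
      ≈⟨ +-cong (reflexive (≡.cong (λ l → l c) (b-row (nonneg v)))) (-‿cong (nonneg-∙ v _)) ⟩
    0# - - g v c    ≈⟨ trans (+-identityˡ _) (-‿involutive _) ⟩
    g v c           ∎

  slack-bound : ∀ g i A c → slack g (bound-row i A) c ≡ limit (bound i A) c - (g ⟦ A ⟧) c
  slack-bound g i A c = ≡.cong₂ (λ x y → x - y)
    (≡.cong (λ l → l c) (b-row (bound i A))) (bound-∙ i A _)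

  nonneg-row∈⇒zero : ∀ g {v} → nonneg-row v ∈ tight g → Zero (g v)
  nonneg-row∈⇒zero g {v} v∈ c = trans (sym (slack-nonneg g v c)) (tight⇒zero g v∈ c)

  zero⇒nonneg-row∈ : ∀ g {v} → Zero (g v) → nonneg-row v ∈ tight g
  zero⇒nonneg-row∈ g {v} z = zero⇒tight g λ c → trans (slack-nonneg g v c) (z c)

  tight-bound : ∀ g {i A} → bound-row i A ∈ tight g → ∀ c → (g ⟦ A ⟧) c ≈ limit (bound i A) c
  tight-bound g {i} {A} t∈ c = begin
    (g ⟦ A ⟧) c           ≈⟨ solve 2 (λ x y → y := x :- (x :- y)) refl (limit (bound i A) c) _ ⟩
    limit (bound i A) c - (limit (bound i A) c - (g ⟦ A ⟧) c)
      ≈⟨ +-congˡ (-‿cong (trans (reflexive (≡.sym (slack-bound g i A c))) (tight⇒zero g t∈ c))) ⟩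
    limit (bound i A) c - 0#   ≈⟨ trans (+-congˡ -0#≈0#) (+-identityʳ _) ⟩
    limit (bound i A) c        ∎

  rank-vector : Fin r → Subset n → Vector Carrier (suc q)
  rank-vector i A zero    = fromℕ (rk i A)
  rank-vector i A (suc k) = 0#

  limit-rank : ∀ {i A} → 1 ℕ.≤ rk i A → fromℕ (1 ℕ.⊔ rk i A) ≈ fromℕ (rk i A)
  limit-rank 1≤rk = reflexive (≡.cong fromℕ (ℕₚ.m≤n⇒m⊔n≡n 1≤rk))

  -- Loops are excluded here because a loop still has the bound 1 in the perturbed polytope.
  LoopFree : Point → Set
  LoopFree g = ∀ v → ¬ Zero (g v) → ∀ i → 1 ℕ.≤ rk i ⁅ v ⁆

  module _ {g : Point} (feas : Feasible g) (loop-free : LoopFree g) where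

    entry-nonneg : ∀ v → LexNonNeg (g v)
    entry-nonneg v = lexNonNeg-resp (slack-nonneg g v) (feas (nonneg-row v))

    below-limit : ∀ i A → LexNonNeg λ c → limit (bound i A) c - (g ⟦ A ⟧) c
    below-limit i A = lexNonNeg-resp (λ c → reflexive (slack-bound g i A c)) (feas (bound-row i A))

    -- A set of rank 0 consists of loops, and `loop-free` keeps them out of the support of `g`.
    rank-zero : ∀ {i A} → rk i A ≡ 0 → Zero (g ⟦ A ⟧)
    rank-zero {i} {A} rk≡0 c = sum-zero term
      where
      term : ∀ v → indicator A v * g v c ≈ 0#
      term v with v ∈? A
      ... | no  v∉A = trans (*-congʳ (reflexive (indicator-∉ v∉A))) (zeroˡ _)
      ... | yes v∈A with zero? (g v)
      ...   | yes z  = trans (*-congˡ (z c)) (zeroʳ _)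
      ...   | no  ¬z = contradiction (loop-free v ¬z i) (ℕₚ.<⇒≱ (ℕ.s≤s (ℕₚ.≤-trans
                (Rank.rank-mono (M i) ⁅v⁆⊆A) (ℕₚ.≤-reflexive rk≡0))))
        where
        ⁅v⁆⊆A : ⁅ v ⁆ ⊆ A
        ⁅v⁆⊆A w∈ = ≡.subst (_∈ A) (≡.sym (x∈⁅y⁆⇒x≡y v w∈)) v∈A

    -- In positive rank the limit is one infinitesimal below the rank. In rank 0 it is above the
    -- rank, and `rank-zero` takes over.
    below-rank : ∀ i A → LexNonNeg λ c → rank-vector i A c - (g ⟦ A ⟧) c
    below-rank i A with rk i A ℕₚ.≟ 0
    ... | yes rk≡0 = inj₂ λ
      { zero    → trans (+-cong (reflexive (≡.cong fromℕ rk≡0)) (-‿cong (rank-zero rk≡0 zero))) (-‿inverseʳ 0#)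
      ; (suc k) → trans (+-congˡ (-‿cong (rank-zero rk≡0 (suc k)))) (-‿inverseʳ 0#) }
    ... | no rk≢0 = lexNonNeg-resp
      (λ c → solve 3 (λ x y z → (x :- y) :+ (y :- z) := x :- z) refl (rank-vector i A c) (limit (bound i A) c) _)
      (lexNonNeg-+ gap (below-limit i A))
      where
      gap : LexNonNeg λ c → rank-vector i A c - limit (bound i A) c
      gap = inj₁ (lexPos-cons (λ c → rank-vector i A c - limit (bound i A) c)
        (≤.reflexive (sym (trans (+-congˡ (-‿cong (limit-rank (ℕₚ.n≢0⇒n>0 rk≢0)))) (-‿inverseʳ _))))
        (lexPos-at (code i A) (pos-resp (sym (trans (+-identityˡ _) (trans (-‿involutive _) (δ-refl (code i A))))) pos-1)
          λ l l<s → trans (+-identityˡ _) (trans (-‿involutive _) (δ-≢ (Finₚ.<⇒≢ l<s ∘ ≡.sym)))))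

    tight⇒rank-positive : ∀ {i A} → bound-row i A ∈ tight g → 1 ℕ.≤ rk i A
    tight⇒rank-positive {i} {A} t∈ = ℕₚ.n≢0⇒n>0 λ rk≡0 → pos⇒≉0 pos-1 (begin
      1#                          ≈⟨ sym (+-identityʳ 1#) ⟩
      fromℕ 1                     ≡⟨ ≡.cong (λ ρ → fromℕ (1 ℕ.⊔ ρ)) rk≡0 ⟨
      limit (bound i A) zero      ≈⟨ sym (tight-bound g t∈ zero) ⟩
      (g ⟦ A ⟧) zero              ≈⟨ rank-zero rk≡0 zero ⟩
      0#                          ∎)

    tight⇒rank : ∀ {i A} → bound-row i A ∈ tight g → (g ⟦ A ⟧) zero ≈ fromℕ (rk i A)
    tight⇒rank t∈ = trans (tight-bound g t∈ zero) (limit-rank (tight⇒rank-positive t∈))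

    measure-mono : ∀ {A B} → A ⊆ B → LexNonNeg λ c → (g ⟦ B ⟧) c - (g ⟦ A ⟧) c
    measure-mono {A} {B} A⊆B = lexNonNeg-resp regroup (lexNonNeg-sum λ v →
      lexNonNeg-scale (≤⇒nonneg (indicator-mono A⊆B v)) (entry-nonneg v))
      where
      regroup : ∀ c → sum (λ v → g v c * (indicator B v - indicator A v)) ≈ (g ⟦ B ⟧) c - (g ⟦ A ⟧) c
      regroup c = trans (sum-cong λ v →
        solve 3 (λ x y z → x :* (y :- z) := y :* x :- z :* x) refl (g v c) (indicator B v) (indicator A v))
        (sum-sub _ _)

    -- With equal ranks the larger set has the smaller limit, because its infinitesimal dominates;
    -- tightness would then give it the smaller measure too.
    tight-nested-rank : ∀ {i A B} → bound-row i A ∈ tight g → bound-row i B ∈ tight g →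
                        A ⊆ B → A ≢ B → rk i A ≢ rk i B
    tight-nested-rank {i} {A} {B} A∈ B∈ A⊆B A≢B rk≡ =
      lexPos-nonNeg-asym drop (lexNonNeg-resp flip (measure-mono A⊆B))
      where
      flip : ∀ c → (g ⟦ B ⟧) c - (g ⟦ A ⟧) c ≈ - (limit (bound i A) c - limit (bound i B) c)
      flip c = trans (+-cong (tight-bound g B∈ c) (-‿cong (tight-bound g A∈ c)))
        (solve 2 (λ x y → x :- y := :- (y :- x)) refl (limit (bound i B) c) (limit (bound i A) c))
      B<A : code i B Fin.< code i A
      B<A = combine-monoʳ-< i (encode-anti A⊆B A≢B)
      drop : LexPos λ c → limit (bound i A) c - limit (bound i B) c
      drop = lexPos-cons (λ c → limit (bound i A) c - limit (bound i B) c)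
        (≤.reflexive (sym (trans (+-congˡ (-‿cong (reflexive (≡.cong (λ ρ → fromℕ (1 ℕ.⊔ ρ)) (≡.sym rk≡)))))
          (-‿inverseʳ _))))
        (lexPos-at (code i B)
          (pos-resp (sym (begin
            - δ (code i A) (code i B) - - δ (code i B) (code i B)
              ≈⟨ +-cong (trans (-‿cong (δ-≢ (Finₚ.<⇒≢ B<A ∘ ≡.sym))) -0#≈0#) (-‿involutive _) ⟩
            0# + δ (code i B) (code i B)  ≈⟨ trans (+-identityˡ _) (δ-refl (code i B)) ⟩
            1#                            ∎)) pos-1)
          λ l l<B → begin
            - δ (code i A) l - - δ (code i B) l
              ≈⟨ +-cong (-‿cong (δ-≢ (Finₚ.<⇒≢ (Finₚ.<-trans l<B B<A) ∘ ≡.sym)))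
                        (-‿cong (-‿cong (δ-≢ (Finₚ.<⇒≢ l<B ∘ ≡.sym)))) ⟩
            - 0# - - 0#   ≈⟨ -‿inverseʳ _ ⟩
            0#            ∎)

    -- The infinitesimal of `A ∪ B` dominates those of `A` and `B`, so the limits of `A` and `B`
    -- together strictly exceed what union and intersection can hold. The intersection is measured
    -- against its rank: its limit has real part 1 even in rank 0, where submodularity of the limits
    -- can fail.
    tight-crossing-rank : ∀ {i A B} → bound-row i A ∈ tight g → bound-row i B ∈ tight g →
                          ¬ A ⊆ B → ¬ B ⊆ A → ⊥
    tight-crossing-rank {i} {A} {B} A∈ B∈ A⊈B B⊈A =
      lexPos-nonNeg-asym strict (lexNonNeg-resp regroup (lexNonNeg-+ (below-limit i (A ∪ B)) (below-rank i (A ∩ B))))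
      where
      excess : Vector Carrier (suc q)
      excess c = (limit (bound i A) c + limit (bound i B) c) - (limit (bound i (A ∪ B)) c + rank-vector i (A ∩ B) c)
      regroup : ∀ c → (limit (bound i (A ∪ B)) c - (g ⟦ A ∪ B ⟧) c) + (rank-vector i (A ∩ B) c - (g ⟦ A ∩ B ⟧) c)
                ≈ - excess c
      regroup c = begin
        (u - gu) + (w - gw)          ≈⟨ solve 4 (λ u gu w gw → (u :- gu) :+ (w :- gw) := (u :+ w) :- (gu :+ gw)) refl u gu w gw ⟩
        (u + w) - (gu + gw)          ≈⟨ +-congˡ (-‿cong (indicator-∪-∩ A B _)) ⟩
        (u + w) - ((g ⟦ A ⟧) c + (g ⟦ B ⟧) c) ≈⟨ +-congˡ (-‿cong (+-cong (tight-bound g A∈ c) (tight-bound g B∈ c))) ⟩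
        (u + w) - (x + y)            ≈⟨ solve 2 (λ p q → p :- q := :- (q :- p)) refl (u + w) (x + y) ⟩
        - ((x + y) - (u + w))        ∎
        where
        u  = limit (bound i (A ∪ B)) c
        gu = (g ⟦ A ∪ B ⟧) c
        w  = rank-vector i (A ∩ B) c
        gw = (g ⟦ A ∩ B ⟧) c
        x  = limit (bound i A) c
        y  = limit (bound i B) c
      α = code i A
      β = code i B
      υ = code i (A ∪ B)
      υ<α : υ Fin.< α
      υ<α = combine-monoʳ-< i (encode-anti (p⊆p∪q B) λ eq → B⊈A (≡.subst (B ⊆_) (≡.sym eq) (q⊆p∪q A B)))
      υ<β : υ Fin.< β
      υ<β = combine-monoʳ-< i (encode-anti (q⊆p∪q A B) λ eq → A⊈B (≡.subst (A ⊆_) (≡.sym eq) (p⊆p∪q B)))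
      positive : ∀ {C} → bound-row i C ∈ tight g → fromℕ (1 ℕ.⊔ rk i C) ≈ fromℕ (rk i C)
      positive C∈ = limit-rank (tight⇒rank-positive C∈)
      head : fromℕ (1 ℕ.⊔ rk i (A ∪ B)) + fromℕ (rk i (A ∩ B)) ≤ fromℕ (1 ℕ.⊔ rk i A) + fromℕ (1 ℕ.⊔ rk i B)
      head = ≤-resp
        (trans (fromℕ-+ (rk i (A ∪ B)) _) (+-congʳ (sym (limit-rank (ℕₚ.≤-trans (tight⇒rank-positive A∈)
          (Rank.rank-mono (M i) (p⊆p∪q B)))))))
        (trans (fromℕ-+ (rk i A) _) (+-cong (sym (positive A∈)) (sym (positive B∈))))
        (fromℕ-mono (Rank.rank-submodular (M i) A B))
      strict : LexPos excess
      strict = lexPos-cons excess (≤⇒nonneg head) (lexPos-at υ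
        (pos-resp (sym (begin
          (- δ α υ + - δ β υ) - (- δ υ υ + 0#)
            ≈⟨ +-cong (+-cong (-‿cong (δ-≢ (Finₚ.<⇒≢ υ<α ∘ ≡.sym))) (-‿cong (δ-≢ (Finₚ.<⇒≢ υ<β ∘ ≡.sym))))
                      (-‿cong (+-congʳ (-‿cong (δ-refl υ)))) ⟩
          (- 0# + - 0#) - (- 1# + 0#)
            ≈⟨ solve 2 (λ o z → (:- z :+ :- z) :- (:- o :+ z) := o :- (z :+ (z :+ z))) refl 1# 0# ⟩
          1# - (0# + (0# + 0#))
            ≈⟨ +-congˡ (-‿cong (trans (+-identityˡ _) (+-identityˡ _))) ⟩
          1# - 0#   ≈⟨ trans (+-congˡ -0#≈0#) (+-identityʳ 1#) ⟩
          1#        ∎)) pos-1)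
        λ l l<υ → begin
          (- δ α l + - δ β l) - (- δ υ l + 0#)
            ≈⟨ +-cong (+-cong (-‿cong (δ-≢ (Finₚ.<⇒≢ (Finₚ.<-trans l<υ υ<α) ∘ ≡.sym)))
                              (-‿cong (δ-≢ (Finₚ.<⇒≢ (Finₚ.<-trans l<υ υ<β) ∘ ≡.sym))))
                      (-‿cong (+-congʳ (-‿cong (δ-≢ (Finₚ.<⇒≢ l<υ ∘ ≡.sym))))) ⟩
          (- 0# + - 0#) - (- 0# + 0#)
            ≈⟨ solve 1 (λ z → (:- z :+ :- z) :- (:- z :+ z) := :- (z :+ z)) refl 0# ⟩
          - (0# + 0#)   ≈⟨ trans (-‿cong (+-identityˡ 0#)) -0#≈0# ⟩
          0#            ∎)

    tight-rank-injective : ∀ {i A B} → bound-row i A ∈ tight g → bound-row i B ∈ tight g →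
                           rk i A ≡ rk i B → A ≡ B
    tight-rank-injective {i} {A} {B} A∈ B∈ rk≡ with A ⊆? B | B ⊆? A
    ... | yes A⊆B | yes B⊆A = ⊆-antisym A⊆B B⊆A
    ... | no  A⊈B | no  B⊈A = ⊥-elim (tight-crossing-rank A∈ B∈ A⊈B B⊈A)
    ... | yes A⊆B | no  B⊈A =
      contradiction rk≡ (tight-nested-rank A∈ B∈ A⊆B λ { ≡.refl → B⊈A λ x → x })
    ... | no  A⊈B | yes B⊆A =
      contradiction (≡.sym rk≡) (tight-nested-rank B∈ A∈ B⊆A λ { ≡.refl → A⊈B λ x → x })

    -- The injection from tight rows to Fin n that sends the row of x_v to v and
    -- the row of (i , A) to the element of index (i , rk A - 1) misses the last
    -- element, although there are n tight rows.
    few-tight-bounds : Vertex g → ∀ {p} → (∀ i A → bound-row i A ∈ tight g → rk i A ℕ.≤ p) →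
      (element : Fin (suc (r ℕ.* p)) → Fin n) → (∀ {x y} → element x ≡ element y → x ≡ y) →
      ¬ (∀ x → ¬ Zero (g (element x)))
    few-tight-bounds V {p} rk≤p element element-injective nonzero =
      injection-misses-none (tight g) (dual-spanning-card (Vertex.dual V) (Vertex.spanning V))
        (λ {t} → φ (row t)) (λ {s} {t} → φ-injective (row s) (row t)) (element last) (λ {t} → φ-misses (row t))
      where
      last : Fin (suc (r ℕ.* p))
      last = Fin.fromℕ (r ℕ.* p)

      rk-1<p : ∀ i A → bound-row i A ∈ tight g → ℕ.pred (rk i A) ℕ.< p
      rk-1<p i A t∈ = ≡.subst (ℕ._≤ p)
        (≡.sym (ℕₚ.suc-pred (rk i A) {{ℕ.>-nonZero (tight⇒rank-positive {i} {A} t∈)}})) (rk≤p i A t∈)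

      index : ∀ i A → bound-row i A ∈ tight g → Fin (r ℕ.* p)
      index i A t∈ = combine i (fromℕ< (rk-1<p i A t∈))

      same-rank : ∀ {i j} A B → i ≡ j → bound-row i A ∈ tight g → bound-row j B ∈ tight g →
                  ℕ.pred (rk i A) ≡ ℕ.pred (rk j B) → bound-row i A ≡ bound-row j B
      same-rank {i} A B ≡.refl s∈ t∈ eq = ≡.cong (bound-row i) (tight-rank-injective {i} {A} {B} s∈ t∈
        (ℕₚ.pred-injective {{ℕ.>-nonZero (tight⇒rank-positive {i} {A} s∈)}}
                           {{ℕ.>-nonZero (tight⇒rank-positive {i} {B} t∈)}} eq))

      index-injective : ∀ {i j A B} (s∈ : bound-row i A ∈ tight g) (t∈ : bound-row j B ∈ tight g) →
                        index i A s∈ ≡ index j B t∈ → bound-row i A ≡ bound-row j B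
      index-injective {i} {j} {A} {B} s∈ t∈ eq = same-rank A B
        (Finₚ.combine-injectiveˡ i s j t eq) s∈ t∈
        (Finₚ.fromℕ<-injective _ _ (rk-1<p i A s∈) (rk-1<p j B t∈) (Finₚ.combine-injectiveʳ i s j t eq))
        where
        s t : Fin p
        s = fromℕ< (rk-1<p i A s∈)
        t = fromℕ< (rk-1<p j B t∈)

      φ : ∀ {t} → Row t → t ∈ tight g → Fin n
      φ (nonneg v)  t∈ = v
      φ (bound i A) t∈ = element (inject₁ (index i A t∈))

      clash : ∀ {v} → nonneg-row v ∈ tight g → ∀ x → v ≢ element x
      clash v∈ x ≡.refl = nonzero x (nonneg-row∈⇒zero g v∈)

      φ-injective : ∀ {s t} (x : Row s) (y : Row t) (s∈ : s ∈ tight g) (t∈ : t ∈ tight g) →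
                    φ x s∈ ≡ φ y t∈ → s ≡ t
      φ-injective (nonneg v)  (nonneg w)  s∈ t∈ eq = ≡.cong nonneg-row eq
      φ-injective (nonneg v)  (bound j B) s∈ t∈ eq = contradiction eq (clash s∈ _)
      φ-injective (bound i A) (nonneg w)  s∈ t∈ eq = contradiction (≡.sym eq) (clash t∈ _)
      φ-injective (bound i A) (bound j B) s∈ t∈ eq =
        index-injective {i} {j} {A} {B} s∈ t∈ (Finₚ.inject₁-injective (element-injective eq))

      φ-misses : ∀ {t} (x : Row t) (t∈ : t ∈ tight g) → φ x t∈ ≢ element last
      φ-misses (nonneg v)  t∈    = clash t∈ last
      φ-misses (bound i A) t∈ eq = Finₚ.fromℕ≢inject₁ (≡.sym (element-injective eq))

-- The rainbow climb

module RainbowSupport (ℝ : CompleteOrderedField) where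
  open CompleteOrderedField ℝ hiding (zero)
  open Ceiling ℝ using (fromℕ)
  open Functions ℝ
  open OrderedField ℝ
  open Lexicographic ℝ
  open LinearAlgebra ℝ
  open Indicators ℝ
  open IntegerSolver commutativeRing using (solve; _:-_; :-_; _:=_)
  open RingProperties ring using (-0#≈0#; -‿involutive; -‿distribˡ-*)

  module RainbowClimb {r n : ℕ} (M : Fin r → Matroid n) (i₀ : Fin r) (k : Carrier)
    {d : ℕ} (f : Fin d → Vector Carrier n)
    (f∈P : ∀ j i → f j ∈P M i) (k≤f : ∀ j → k ≤ ∥ f j ∥)
    (enough : 0# < k → ∃[ p ] (∀ ρ → ¬ (k ≤ fromℕ ρ) → ρ ℕ.≤ p) × suc (r ℕ.* p) ℕ.≤ d)
    where

    open PerturbedPolytope ℝ M i₀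

    -- The choice only has to cover the support, since a move may make further entries vanish;
    -- `minimise` restores equality before colours are counted.
    record Rainbow (g : Point) : Set where
      field
        choice   : Fin d → Maybe (Fin n)
        chosen   : ∀ {j v} → choice j ≡ just v → ¬ (f j v ≈ 0#)
        distinct : ∀ {i j v} → choice i ≡ just v → choice j ≡ just v → i ≡ j
        covers   : ∀ v → ¬ Zero (g v) → ∃[ j ] choice j ≡ just v

    Minimal : ∀ {g} → Rainbow g → Set
    Minimal {g} R = ∀ {j v} → Rainbow.choice R j ≡ just v → ¬ Zero (g v)

    minimise : ∀ {g} → Rainbow g → ∃ (Minimal {g})
    minimise {g} R = record
      { choice   = λ j → keep nonzero? (choice j)
      ; chosen   = λ {j} eq → chosen (proj₁ (keep⁻ nonzero? (choice j) eq))
      ; distinct = λ {i} {j} eq eq′ → distinct (proj₁ (keep⁻ nonzero? (choice i) eq))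
                                               (proj₁ (keep⁻ nonzero? (choice j) eq′))
      ; covers   = λ v ¬z → proj₁ (covers v ¬z) , keep⁺ nonzero? (proj₂ (covers v ¬z)) ¬z
      } , λ {j} eq → proj₂ (keep⁻ nonzero? (choice j) eq)
      where
      open Rainbow R
      nonzero? : ∀ v → Dec (¬ Zero (g v))
      nonzero? v = ¬? (zero? (g v))

    f-nonneg : ∀ j v → 0# ≤ f j v
    f-nonneg j = proj₁ (f∈P j i₀)

    -- A chosen `v` is positive in some `f j`, which lies in every polytope, so `⁅ v ⁆` has nonzero
    -- rank in each matroid.
    loop-free : ∀ {g} → Rainbow g → LoopFree g
    loop-free R v ¬z i with Rainbow.covers R v ¬z
    ... | j , eq = ℕₚ.n≢0⇒n>0 λ rk≡0 → Rainbow.chosen R eq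
      (≤.antisym (≤-resp (trans (sym (indicator-∙ ⁅ v ⁆ (f j))) (indicator-⁅⁆ v (f j)))
        (reflexive (≡.cong fromℕ rk≡0)) (proj₂ (f∈P j i) ⁅ v ⁆)) (f-nonneg j v))

    entry-head : ∀ {g} → Feasible g → Rainbow g → ∀ v → 0# ≤ g v zero
    entry-head {g} feas R v = lexNonNeg-head (entry-nonneg {g} feas (loop-free R) v)

    measure≤value : ∀ {g} → Feasible g → Rainbow g → ∀ A → (g ⟦ A ⟧) zero ≤ value g zero
    measure≤value {g} feas R A = sum-mono term
      where
      term : ∀ v → indicator A v * g v zero ≤ g v zero
      term v with v ∈? A
      ... | yes v∈ = ≤.reflexive (trans (*-congʳ (reflexive (indicator-∈ v∈))) (*-identityˡ _))
      ... | no  v∉ = ≤-resp (sym (trans (*-congʳ (reflexive (indicator-∉ v∉))) (zeroˡ _))) refl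
                       (entry-head {g} feas R v)

    module _ {g : Point} (V : Vertex g) (R : Rainbow g) (minimal : Minimal R) (k≰g : ¬ (k ≤ value g zero)) where
      open Vertex V
      open Rainbow R

      -- The real part of the value is nonnegative, so a nonpositive `k` would already be reached.
      k-positive : 0# < k
      k-positive with sign k
      ... | pos p = p
      ... | nil z = contradiction (≤-resp (sym z) refl (sum-nonneg (entry-head {g} feasible R))) k≰g
      ... | neg p = contradiction (≤.trans (neg-nonneg⇒nonpos (proj₁ p)) (sum-nonneg (entry-head {g} feasible R))) k≰g

      -- If every colour were used, minimality would give `d` distinct nonzero entries. That is too
      -- many: the rank of a tight set is the real part of its measure, so it stays below `k` and is
      -- at most `p`.
      unused : ∃[ j ] choice j ≡ nothing
      unused with Finₚ.any? (λ j → Maybeₚ.≡-dec Finₚ._≟_ (choice j) nothing)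
      ... | yes found    = found
      ... | no  all-used = ⊥-elim (contradict (enough k-positive))
        where
        used : ∀ j → ∃[ v ] choice j ≡ just v
        used j = helper (choice j) λ eq → all-used (j , eq)
          where
          helper : ∀ x → x ≢ nothing → ∃[ v ] x ≡ just v
          helper nothing  x≢ = contradiction ≡.refl x≢
          helper (just v) _  = v , ≡.refl

        contradict : ¬ (∃[ p ] (∀ ρ → ¬ (k ≤ fromℕ ρ) → ρ ℕ.≤ p) × suc (r ℕ.* p) ℕ.≤ d)
        contradict (p , rank≤p , rp<d) = few-tight-bounds {g} feasible (loop-free R) V
          (λ i A t∈ → rank≤p (rk i A) λ k≤rk → k≰g (≤.trans k≤rk (≤-resp
            (tight⇒rank {g} feasible (loop-free R) {i} {A} t∈) refl (measure≤value {g} feasible R A))))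
          (λ x → proj₁ (used (inject≤ x rp<d)))
          (λ {x} {y} eq → Finₚ.inject≤-injective rp<d rp<d x y (distinct
            (proj₂ (used (inject≤ x rp<d)))
            (≡.trans (proj₂ (used (inject≤ y rp<d))) (≡.cong just (≡.sym eq)))))
          (λ x → minimal (proj₂ (used (inject≤ x rp<d))))

    -- Releasing the nonnegativity row of `v` lets `v` into the support, and colour `j` must be able
    -- to pay for it; releasing a bound lets nothing in.
    Entering : Fin d → ∀ {t} → Row t → Set
    Entering j (nonneg v)  = ¬ (f j v ≈ 0#)
    Entering j (bound i A) = ⊤

    entering? : ∀ j {t} (x : Row t) → Dec (Entering j x)
    entering? j (nonneg v)  = ¬? (f j v ≟ 0#)
    entering? j (bound i A) = yes tt

    module _ {g : Point} (V : Vertex g) (j : Fin d)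
      (optimal : ∀ {t} (x : Row t) → t ∈ tight g → Entering j x → ¬ Pos (- sum (Vertex.edges V t))) where
      open Vertex V

      private
        w : Vector Carrier n
        w v = f j v - g v zero

        nonpos-* : ∀ {x y} → x ≤ 0# → 0# ≤ y → x * y ≤ 0#
        nonpos-* x≤0 0≤y = neg-nonneg⇒nonpos
          (≤-resp refl (sym (-‿distribˡ-* _ _)) (*-nonNeg (nonpos⇒neg-nonneg x≤0) 0≤y))

        edge-nonneg : ∀ {t} (x : Row t) → t ∈ tight g → Entering j x → 0# ≤ sum (edges t)
        edge-nonneg x t∈ e = ≤-resp refl (-‿involutive _) (nonpos⇒neg-nonneg (¬pos⇒≤0 (optimal x t∈ e)))

        -- On bound rows `w` has nonpositive rate, because `f j` obeys the original bound; on the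
        -- row of `v` its rate is `- f j v`. The only edges of unknown sign belong to `v` outside
        -- the support of `f j`, where the rate is zero.
        tight-term : ∀ {t} (x : Row t) → t ∈ tight g → (a t ∙ w) * sum (edges t) ≤ 0#
        tight-term (bound i A) t∈ = nonpos-* a∙w≤0 (edge-nonneg (bound i A) t∈ tt)
          where
          measures : indicator A ∙ f j ≤ (g ⟦ A ⟧) zero
          measures = ≤-resp (sym (indicator-∙ A (f j))) (sym (tight-bound g {i} {A} t∈ zero))
            (≤.trans (proj₂ (f∈P j i) A) (fromℕ-mono (ℕₚ.m≤n⊔m 1 (rk i A))))
          a∙w≤0 : a (bound-row i A) ∙ w ≤ 0#
          a∙w≤0 = neg-nonneg⇒nonpos (≤-resp refl
            (trans (solve 2 (λ x y → x :- y := :- (y :- x)) refl ((g ⟦ A ⟧) zero) (indicator A ∙ f j))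
              (-‿cong (sym (trans (reflexive (bound-∙ i A w)) (∙-sub (indicator A) (f j) _)))))
            (≤⇒nonneg measures))
        tight-term (nonneg v) t∈ = by-support (f j v ≟ 0#)
          where
          a∙w : a (nonneg-row v) ∙ w ≈ - f j v
          a∙w = trans (nonneg-∙ v w) (-‿cong (trans
            (+-congˡ (trans (-‿cong (nonneg-row∈⇒zero g t∈ zero)) -0#≈0#)) (+-identityʳ _)))
          by-support : Dec (f j v ≈ 0#) → (a (nonneg-row v) ∙ w) * sum (edges (nonneg-row v)) ≤ 0#
          by-support (yes z) = ≤.reflexive
            (trans (*-congʳ (trans a∙w (trans (-‿cong z) -0#≈0#))) (zeroˡ _))
          by-support (no ¬z) = nonpos-*
            (neg-nonneg⇒nonpos (≤-resp refl (trans (sym (-‿involutive _)) (-‿cong (sym a∙w))) (f-nonneg j v)))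
            (edge-nonneg (nonneg v) t∈ ¬z)

        term : ∀ t → (a t ∙ w) * sum (edges t) ≤ 0#
        term t with t ∈? tight g
        ... | yes t∈ = tight-term (row t) t∈
        ... | no  t∉ = ≤.reflexive (trans (*-congˡ (sum-zero (Dual.outside dual t∉))) (zeroʳ _))

        sum-w : sum w ≈ sum λ t → (a t ∙ w) * sum (edges t)
        sum-w = trans (sum-cong (expansion spanning w)) (trans (sum-comm _)
          (sum-cong λ t → sym (*-distribˡ-sum (a t ∙ w) (edges t))))

      -- f j - g is a combination of the edges at g, none of which gains.
      f≤value : sum (f j) ≤ value g zero
      f≤value = nonneg⇒≤ (≤-resp refl
        (trans (-‿cong (sum-sub (f j) (λ v → g v zero)))
          (solve 2 (λ x y → :- (x :- y) := y :- x) refl (sum (f j)) (value g zero)))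
        (nonpos⇒neg-nonneg (≤-resp (sym sum-w) (sum-replicate-zero _) (sum-mono term))))

    norm≈sum : ∀ (h : Vector Carrier n) → ∥ h ∥ ≈ sum h
    norm≈sum h = trans (sym (indicator-∙ Subset.⊤ h)) (sum-cong λ v →
      trans (*-congʳ (reflexive (indicator-∈ {n} {Subset.⊤} {v} ∈⊤))) (*-identityˡ _))

    exchange : ∀ {g h t} (R : Rainbow g) → Minimal R → ∀ {j} → Rainbow.choice R j ≡ nothing →
      (x : Row t) → Entering j x → t ∈ tight g →
      (∀ {s} → s ∈ tight g → s ≢ t → s ∈ tight h) → Rainbow h
    exchange {g} {h} R minimal {j} unused (bound i A) _ _ keeps = record
      { choice = choice ; chosen = chosen ; distinct = distinct
      ; covers = λ v ¬z → covers v λ z → ¬z (nonneg-row∈⇒zero h (keeps (zero⇒nonneg-row∈ g z) disjoint)) }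
      where open Rainbow R
    exchange {g} {h} R minimal {j} unused (nonneg v) fjv≉0 v∈ keeps = record
      { choice = choice⁺ ; chosen = chosen⁺ _ ; distinct = distinct⁺ _ _ ; covers = covers⁺ }
      where
      open Rainbow R
      choice⁺ : Fin d → Maybe (Fin n)
      choice⁺ i with i Finₚ.≟ j
      ... | yes _ = just v
      ... | no  _ = choice i
      chosen⁺ : ∀ i {w} → choice⁺ i ≡ just w → ¬ (f i w ≈ 0#)
      chosen⁺ i eq with i Finₚ.≟ j
      chosen⁺ i ≡.refl | yes ≡.refl = fjv≉0
      chosen⁺ i eq     | no  _      = chosen eq
      fresh : ∀ {i w} → choice i ≡ just w → w ≢ v
      fresh eq ≡.refl = minimal eq (nonneg-row∈⇒zero g v∈)
      distinct⁺ : ∀ i i′ {w} → choice⁺ i ≡ just w → choice⁺ i′ ≡ just w → i ≡ i′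
      distinct⁺ i i′ eq eq′ with i Finₚ.≟ j | i′ Finₚ.≟ j
      ... | yes i≡j | yes i′≡j = ≡.trans i≡j (≡.sym i′≡j)
      ... | yes _   | no  _    = contradiction (≡.sym (Maybeₚ.just-injective eq)) (fresh eq′)
      ... | no  _   | yes _    = contradiction (≡.sym (Maybeₚ.just-injective eq′)) (fresh eq)
      ... | no  _   | no  _    = distinct eq eq′
      choice⁺-new : choice⁺ j ≡ just v
      choice⁺-new with j Finₚ.≟ j
      ... | yes _  = ≡.refl
      ... | no j≢j = contradiction ≡.refl j≢j
      choice⁺-old : ∀ {i w} → choice i ≡ just w → choice⁺ i ≡ just w
      choice⁺-old {i} eq with i Finₚ.≟ j
      ... | yes ≡.refl = contradiction (≡.trans (≡.sym unused) eq) λ ()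
      ... | no  _      = eq
      covers⁺ : ∀ w → ¬ Zero (h w) → ∃[ i ] choice⁺ i ≡ just w
      covers⁺ w ¬z with w Finₚ.≟ v
      ... | yes ≡.refl = j , choice⁺-new
      ... | no  w≢v = let i , eq = covers w λ z → ¬z (nonneg-row∈⇒zero h
                                     (keeps (zero⇒nonneg-row∈ g z) (w≢v ∘ Finₚ.↑ˡ-injective q w v)))
                      in i , choice⁺-old eq

    Result : Set
    Result = ∃[ g ] Feasible g × Rainbow g × k ≤ value g zero

    step : ∀ g → Vertex g → Rainbow g → Result ⊎ ∃[ h ] Vertex h × Rainbow h × g ≺ h
    step g V R = by-value (k ≤? value g zero)
      where
      open Vertex V
      Next : Set
      Next = ∃[ h ] Vertex h × Rainbow h × g ≺ h

      Gainful : Fin d → Fin (n ℕ.+ q) → Set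
      Gainful j t = t ∈ tight g × Pos (- sum (edges t)) × Entering j (row t)

      gainful? : ∀ j t → Dec (Gainful j t)
      gainful? j t = t ∈? tight g ×-dec pos? _ ×-dec entering? j (row t)

      move-along : ∀ {j} (R : Rainbow g) → Minimal R → Rainbow.choice R j ≡ nothing → ∃ (Gainful j) → Next
      move-along R minimal unused (t , t∈ , gain , e) =
        let h , W , g≺h , keeps = improve {g} V t∈ gain
        in h , W , exchange {g} {h} R minimal unused (row t) e t∈ keeps , g≺h

      by-value : Dec (k ≤ value g zero) → Result ⊎ Next
      by-value (yes k≤g) = inj₁ (g , feasible , R , k≤g)
      by-value (no  k≰g) = by-colour (minimise R)
        where
        by-colour : ∃ (Minimal {g}) → Result ⊎ Next
        by-colour (R′ , minimal) = by-edge (unused {g} V R′ minimal k≰g)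
          where
          by-edge : ∃[ j ] Rainbow.choice R′ j ≡ nothing → Result ⊎ Next
          by-edge (j , free) with Finₚ.any? (gainful? j)
          ... | yes gainful = inj₂ (move-along R′ minimal free gainful)
          ... | no  none    = contradiction
            (≤.trans (k≤f j) (≤-resp (sym (norm≈sum (f j))) refl (f≤value {g} V j optimal))) k≰g
            where
            optimal : ∀ {t} (x : Row t) → t ∈ tight g → Entering j x → ¬ Pos (- sum (edges t))
            optimal {t} x t∈ e gain = none (t , t∈ , gain , ≡.subst (Entering j) (row-irrelevant x (row t)) e)

    origin : Point
    origin v c = 0#

    origin-feasible : Feasible origin
    origin-feasible t = by-row (row t)
      where
      by-row : ∀ {t} → Row t → LexNonNeg (slack origin t)
      by-row (nonneg v)  = inj₂ (slack-nonneg origin v)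
      by-row (bound i A) = inj₁ (inj₁ (pos-resp (sym (trans (reflexive (slack-bound origin i A zero))
        (trans (+-congˡ (trans (-‿cong (∙-zeroʳ (indicator A) λ _ → refl)) -0#≈0#)) (+-identityʳ _))))
        (pos-fromℕ (ℕₚ.m≤m⊔n 1 (rk i A)))))

    result : Result
    result =
      -- All rows tight at the origin stay tight, so the starting vertex has empty support and the
      -- empty choice covers it.
      let g , V , ⊆g , _ = purify origin origin-feasible
      in climb step g V record
        { choice   = λ _ → nothing
        ; chosen   = λ ()
        ; distinct = λ ()
        ; covers   = λ v ¬z → contradiction
            (nonneg-row∈⇒zero g (⊆g (zero⇒nonneg-row∈ origin λ _ → refl))) ¬z }

    ∈-supp⁺ : ∀ {h : Vector Carrier n} {v} → ¬ (h v ≈ 0#) → v ∈ supp h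
    ∈-supp⁺ {h} {v} h≉0 = Vecₚ.lookup⇒[]= v (supp h)
      (≡.trans (Vecₚ.lookup∘tabulate _ v) (dec-true (¬? (h v ≟ 0#)) h≉0))

    ∈-supp⁻ : ∀ {h : Vector Carrier n} {v} → v ∈ supp h → ¬ (h v ≈ 0#)
    ∈-supp⁻ {h} {v} v∈ z = contradiction
      (≡.trans (≡.sym (Vecₚ.[]=⇒lookup v∈)) (≡.trans (Vecₚ.lookup∘tabulate _ v)
        (dec-false (¬? (h v ≟ 0#)) λ ¬z → ¬z z))) λ ()

    rainbow-function : ∃[ h ] (∀ i → h ∈P M i) × IsRainbow (λ j → supp (f j)) (supp h) × k ≤ ∥ h ∥
    rainbow-function = extract result
      where
      extract : Result → ∃[ h ] (∀ i → h ∈P M i) × IsRainbow (λ j → supp (f j)) (supp h) × k ≤ ∥ h ∥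
      extract (g , feas , R , k≤g) = h , h∈P ,
        ((λ j → keep h≉0? (choice j)) ,
         (λ j v eq → ∈-supp⁺ (chosen (proj₁ (keep⁻ h≉0? (choice j) eq)))) ,
         (λ v → mk⇔ (λ v∈ → let ¬z = ∈-supp⁻ v∈ ; j , eq = covers v (λ z → ¬z (z zero))
                            in j , keep⁺ h≉0? eq ¬z)
                    (λ (j , eq) → ∈-supp⁺ (proj₂ (keep⁻ h≉0? (choice j) eq)))) ,
         λ i j v eq eq′ → distinct (proj₁ (keep⁻ h≉0? (choice i) eq)) (proj₁ (keep⁻ h≉0? (choice j) eq′))) ,
        ≤-resp refl (sym (norm≈sum h)) k≤g
        where
        open Rainbow R
        h : Vector Carrier n
        h v = g v zero
        -- A nonzero entry of `g` can be purely infinitesimal and vanish in `h`, so the choice is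
        -- cut down to the real support.
        h≉0? : ∀ v → Dec (¬ (h v ≈ 0#))
        h≉0? v = ¬? (h v ≟ 0#)
        h∈P : ∀ i → h ∈P M i
        h∈P i = entry-head {g} feas R , λ A → ≤-resp (indicator-∙ A h) refl
          (nonneg⇒≤ (lexNonNeg-head (below-rank {g} feas (loop-free R) i A)))

-- The number of colours

module CeilingBound (ℝ : CompleteOrderedField) where
  open CompleteOrderedField ℝ hiding (zero)
  open Ceiling ℝ using (fromℕ; fromℤ)
  open OrderedField ℝ

  -- With `c` in the role of ⌈k⌉, take p = c - 1: a natural number below k is below c, and r c - r +
  -- 1 = r p + 1. A nonpositive `c` contradicts 0 < k.
  ceiling-bound : ∀ r {k} c → k ≤ fromℤ c → 0# < k →
    ∃[ p ] (∀ ρ → ¬ (k ≤ fromℕ ρ) → ρ ℕ.≤ p) ×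
           suc (r ℕ.* p) ℕ.≤ size (+ r ℤ.* c ℤ.- + r ℤ.+ + 1)
  ceiling-bound r (+ zero) k≤0 0<k = contradiction (≤.antisym k≤0 (proj₁ 0<k)) (pos⇒≉0 0<k)
  ceiling-bound r -[1+ m ] k≤c 0<k = contradiction
    (≤.antisym (≤.trans k≤c (neg-nonneg⇒nonpos (≤-resp refl (sym (-‿involutive _)) (fromℕ-nonneg (suc m)))))
      (proj₁ 0<k)) (pos⇒≉0 0<k)
    where open RingProperties ring using (-‿involutive)
  ceiling-bound r (+ suc p) k≤c 0<k = p ,
    (λ ρ k≰ρ → ℕₚ.≮⇒≥ λ p<ρ → k≰ρ (≤.trans k≤c (fromℕ-mono p<ρ))) ,
    ℕₚ.≤-reflexive (≡.sym (≡.cong size degree))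
    where
    open ≡.≡-Reasoning
    degree : + r ℤ.* + suc p ℤ.- + r ℤ.+ + 1 ≡ + suc (r ℕ.* p)
    degree = begin
      + r ℤ.* + suc p ℤ.- + r ℤ.+ + 1        ≡⟨ ≡.cong (λ x → x ℤ.- + r ℤ.+ + 1) (ℤₚ.pos-* r (suc p)) ⟨
      + (r ℕ.* suc p) ℤ.- + r ℤ.+ + 1        ≡⟨ ≡.cong (λ x → + x ℤ.- + r ℤ.+ + 1) (≡.trans (ℕₚ.*-suc r p) (ℕₚ.+-comm r _)) ⟩
      (+ (r ℕ.* p) ℤ.+ + r) ℤ.- + r ℤ.+ + 1  ≡⟨ ≡.cong (ℤ._+ + 1) (ℤₚ.+-assoc (+ (r ℕ.* p)) (+ r) (ℤ.- + r)) ⟩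
      + (r ℕ.* p) ℤ.+ (+ r ℤ.- + r) ℤ.+ + 1  ≡⟨ ≡.cong (λ x → + (r ℕ.* p) ℤ.+ x ℤ.+ + 1) (ℤₚ.+-inverseʳ (+ r)) ⟩
      + (r ℕ.* p) ℤ.+ + 0 ℤ.+ + 1            ≡⟨ ≡.cong (ℤ._+ + 1) (ℤₚ.+-identityʳ (+ (r ℕ.* p))) ⟩
      + (r ℕ.* p ℕ.+ 1)                      ≡⟨ ≡.cong +_ (ℕₚ.+-comm (r ℕ.* p) 1) ⟩
      + suc (r ℕ.* p)                        ∎

theorem1p6 : (ℝ : CompleteOrderedField) →
  let open CompleteOrderedField ℝ using (Carrier)
      open CompleteOrderedField ℝ using (_≤_)
      open Ceiling ℝ using (⌈_⌉)
      open Functions ℝ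
  in
  (r : ℕ) → 1 ≤ℕ r →
  (n : ℕ) (M : Fin r → Matroid n) (k : Carrier) →
  let d = + r *ℤ ⌈ k ⌉ -ℤ + r +ℤ + 1 in
  (f : Fin (size d) → Vector Carrier n) →
  (∀ j i → f j ∈P M i) →
  (∀ j → k ≤ ∥ f j ∥) →
  ∃[ g ] (∀ i → g ∈P M i) × IsRainbow (λ j → supp (f j)) (supp g) × k ≤ ∥ g ∥
theorem1p6 ℝ (suc r) _ n M k f f∈P k≤f = RainbowSupport.RainbowClimb.rainbow-function ℝ M zero k f f∈P k≤f
  (CeilingBound.ceiling-bound ℝ (suc r) (Ceiling.⌈_⌉ ℝ k) (proj₁ (proj₂ (Ceiling.ceiling ℝ k))))
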